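{- As $n\to\infty$, $$z_3(n, K(2,2,7)) = n^{11/4-o(1)},$$ that is, $\dfrac{\log z_3(n,K(2,2,7))}{\log n}\to \dfrac{11}{4}$ as $n\to\infty$.
   Context: $K(2,2,7)$ denotes the complete $3$-partite $3$-uniform hypergraph: its vertex set is a disjoint union of sets $S_1,S_2,S_3$ with $|S_1|=|S_2|=2$, $|S_3|=7$, and its edges are all sets $\{x_1,x_2,x_3\}$ with $x_i\in S_i$. The Zarankiewicz number $z_3(n,K(2,2,7))$ is the maximum number of edges in a $3$-partite $3$-uniform hypergraph $H$ with (ordered, disjoint) parts $X_1,X_2,X_3$, each of size $n$ (every edge has exactly one vertex in each part), such that there is no copy of $K(2,2,7)$ in $H$ with $S_i\subset X_i$ for $i=1,2,3$; copies placed with some $S_i\not\subset X_i$ are allowed. -}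

module Defs where

open import Data.Bool.Base using (true; false)
open import Data.Fin.Base using (Fin; combine)
open import Data.Fin.Properties using (all?)
open import Data.Fin.Subset using (Subset; inside; outside; _∈_; ∣_∣; Nonempty)
  renaming (⊥ to ∅)
open import Data.Fin.Subset.Properties using (_∈?_; anySubset?; ∉⊥; ∣⊥∣≡0; nonempty?; Empty-unique)
open import Data.Integer.Base using (+_; -[1+_])
open import Data.List.Base using (List; []; _∷_; [_]; _++_; map; filter)
open import Data.List.Extrema.Nat using (max; xs≤max; argmax-sel)
open import Data.List.Membership.Propositional using () renaming (_∈_ to _∈ᴸ_)
open import Data.List.Membership.Propositional.Properties
  using (∈-map⁺; ∈-map⁻; ∈-++⁺ˡ; ∈-++⁺ʳ; ∈-filter⁺; ∈-filter⁻)
open import Data.List.Relation.Unary.All using (lookup)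
open import Data.List.Relation.Unary.Any using (here)
open import Data.Nat.Base using (ℕ; zero; suc; _*_; _^_; _≤_; _<_; NonZero; ≢-nonZero⁻¹)
open import Data.Nat.Properties using (_≟_)
open import Data.Product.Base using (∃-syntax; _×_; _,_; proj₁; proj₂)
open import Data.Rational.Unnormalised.Base as ℚᵘ using (ℚᵘ; mkℚᵘ; 0ℚᵘ)
open import Data.Sum.Base using (inj₁; inj₂)
import Data.Vec.Base as Vec
open import Function.Base using (id)
open import Relation.Binary.PropositionalEquality using (_≡_; refl; sym; trans; cong)
open import Relation.Nullary.Decidable using (Dec; yes; no; _×-dec_; _→-dec_; ¬?)
open import Relation.Nullary.Negation using (¬_; contradiction)

-- A 3-partite 3-uniform hypergraph whose parts X₁, X₂, X₃ are three disjoint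
-- copies of Fin n.  An edge has exactly one vertex in each part, so the edge set
-- is a subset of X₁ × X₂ × X₃, which `combine` identifies with Fin (n * (n * n)).

record Hypergraph (n : ℕ) : Set where
  constructor hypergraph
  field
    edges : Subset (n * (n * n))

open Hypergraph public

#edges : ∀ {n} → Hypergraph n → ℕ
#edges H = ∣ edges H ∣

Edge : ∀ {n} → Hypergraph n → Fin n → Fin n → Fin n → Set
Edge H x₁ x₂ x₃ = combine x₁ (combine x₂ x₃) ∈ edges H

-- H contains K(s₁,s₂,s₃) with Sᵢ ⊂ Xᵢ for i = 1, 2, 3, in this order; copies
-- whose sides are placed in the parts in another order do not count.

ContainsK : ∀ {n} → ℕ → ℕ → ℕ → Hypergraph n → Set
ContainsK {n} s₁ s₂ s₃ H =
  ∃[ S₁ ] ∃[ S₂ ] ∃[ S₃ ]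
    (∣ S₁ ∣ ≡ s₁ × ∣ S₂ ∣ ≡ s₂ × ∣ S₃ ∣ ≡ s₃ ×
     ((x₁ x₂ x₃ : Fin n) → x₁ ∈ S₁ → x₂ ∈ S₂ → x₃ ∈ S₃ → Edge H x₁ x₂ x₃))

KFree : ∀ {n} → ℕ → ℕ → ℕ → Hypergraph n → Set
KFree s₁ s₂ s₃ H = ¬ ContainsK s₁ s₂ s₃ H

KFree? : ∀ {n} s₁ s₂ s₃ (H : Hypergraph n) → Dec (KFree s₁ s₂ s₃ H)
KFree? s₁ s₂ s₃ H = ¬? (
  anySubset? λ S₁ → anySubset? λ S₂ → anySubset? λ S₃ →
    (∣ S₁ ∣ ≟ s₁) ×-dec (∣ S₂ ∣ ≟ s₂) ×-dec (∣ S₃ ∣ ≟ s₃) ×-dec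
    all? λ x₁ → all? λ x₂ → all? λ x₃ →
      (x₁ ∈? S₁) →-dec (x₂ ∈? S₂) →-dec (x₃ ∈? S₃) →-dec
      (combine x₁ (combine x₂ x₃) ∈? edges H))

allSubsets : ∀ n → List (Subset n)
allSubsets zero    = [ Vec.[] ]
allSubsets (suc n) = map (inside Vec.∷_) (allSubsets n) ++ map (outside Vec.∷_) (allSubsets n)

∈-allSubsets : ∀ {n} (S : Subset n) → S ∈ᴸ allSubsets n
∈-allSubsets Vec.[]            = here refl
∈-allSubsets (true  Vec.∷ S) = ∈-++⁺ˡ (∈-map⁺ _ (∈-allSubsets S))
∈-allSubsets (false Vec.∷ S) = ∈-++⁺ʳ _ (∈-map⁺ _ (∈-allSubsets S))

KFreeHypergraphs : ∀ n → ℕ → ℕ → ℕ → List (Hypergraph n)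
KFreeHypergraphs n s₁ s₂ s₃ = filter (KFree? s₁ s₂ s₃) (map hypergraph (allSubsets (n * (n * n))))

-- The default value 0 of `max` is attained by the empty hypergraph as soon as
-- s₁, s₂, s₃ ≥ 1, see z₃-attained.

z₃ : ℕ → ℕ → ℕ → ℕ → ℕ
z₃ n s₁ s₂ s₃ = max 0 (map #edges (KFreeHypergraphs n s₁ s₂ s₃))

z₃-upper : ∀ {n s₁ s₂ s₃} (H : Hypergraph n) → KFree s₁ s₂ s₃ H → #edges H ≤ z₃ n s₁ s₂ s₃
z₃-upper {n} {s₁} {s₂} {s₃} H free =
  lookup (xs≤max 0 (map #edges (KFreeHypergraphs n s₁ s₂ s₃)))
    (∈-map⁺ #edges (∈-filter⁺ (KFree? s₁ s₂ s₃) (∈-map⁺ hypergraph (∈-allSubsets (edges H))) free))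

nonempty : ∀ {n s} .{{_ : NonZero s}} (S : Subset n) → ∣ S ∣ ≡ s → Nonempty S
nonempty {n} {s} S eq with nonempty? S
... | yes ne = ne
... | no  ¬ne = contradiction
  (trans (sym eq) (trans (cong ∣_∣ (Empty-unique ¬ne)) (∣⊥∣≡0 n))) (≢-nonZero⁻¹ s)

∅-KFree : ∀ {n s₁ s₂ s₃} .{{_ : NonZero s₁}} .{{_ : NonZero s₂}} .{{_ : NonZero s₃}} →
          KFree {n} s₁ s₂ s₃ (hypergraph ∅)
∅-KFree (S₁ , S₂ , S₃ , e₁ , e₂ , e₃ , K) =
  let x₁ , p₁ = nonempty S₁ e₁
      x₂ , p₂ = nonempty S₂ e₂
      x₃ , p₃ = nonempty S₃ e₃
  in ∉⊥ (K x₁ x₂ x₃ p₁ p₂ p₃)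

z₃-attained : ∀ n s₁ s₂ s₃ .{{_ : NonZero s₁}} .{{_ : NonZero s₂}} .{{_ : NonZero s₃}} →
              ∃[ H ] (KFree {n} s₁ s₂ s₃ H × #edges H ≡ z₃ n s₁ s₂ s₃)
z₃-attained n s₁ s₂ s₃ with argmax-sel id 0 (map #edges (KFreeHypergraphs n s₁ s₂ s₃))
... | inj₁ z≡0 = hypergraph ∅ , ∅-KFree , trans (∣⊥∣≡0 (n * (n * n))) (sym z≡0)
... | inj₂ z∈  =
  let H , H∈ , z≡#H = ∈-map⁻ #edges z∈
  in H , proj₂ (∈-filter⁻ (KFree? s₁ s₂ s₃) {xs = map hypergraph (allSubsets (n * (n * n)))} H∈) , sym z≡#H

-- For n ≥ 2 and m ≥ 1 the real number log m / log n is represented by its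
-- rational cuts: for an integer a and d ≥ 1,
--   a / d < log m / log n  ⇔  a log n < d log m  ⇔  nᵃ < mᵈ,
-- and symmetrically.  If a is negative, the factor n^∣a∣ is moved to the other side.
-- For m = 0 and n ≥ 2 the formulas give the value -∞.

infix 4 _<log_/log_ log_/log_<_

_<log_/log_ : ℚᵘ → ℕ → ℕ → Set
mkℚᵘ (+ a)    d-1 <log m /log n = n ^ a < m ^ suc d-1
mkℚᵘ -[1+ a ] d-1 <log m /log n = 1 < m ^ suc d-1 * n ^ suc a

log_/log_<_ : ℕ → ℕ → ℚᵘ → Set
log m /log n < mkℚᵘ (+ a)    d-1 = m ^ suc d-1 < n ^ a
log m /log n < mkℚᵘ -[1+ a ] d-1 = m ^ suc d-1 * n ^ suc a < 1

-- log f(n) / log n → L as n → ∞: for each rational ε > 0,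
-- L - ε < log f(n) / log n < L + ε for all sufficiently large n.

LogRatioTendsTo : (ℕ → ℕ) → ℚᵘ → Set
LogRatioTendsTo f L =
  ∀ (ε : ℚᵘ) → 0ℚᵘ ℚᵘ.< ε →
  ∃[ N ] ∀ n → N ≤ n →
    (L ℚᵘ.- ε <log f n /log n) × (log f n /log n < L ℚᵘ.+ ε)

{-# OPTIONS --safe #-}

-- Upper bound: by Cauchy–Schwarz twice, e edges contain at least e⁴/n⁷ homomorphic copies of
-- K(2,2,1).  If there is no K(2,2,7), then all but O(n³) of the n⁴ quadruples (x, x′, y, y′) extend
-- to at most 6 of them and the rest to at most n, so e⁴ ≤ 8n¹¹.
--
-- Lower bound: the projective norm graph over 𝔽ₚ (vertices (A, c) ∈ 𝔽ₚ³ × 𝔽ₚ*, joined to (B, b)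
-- when c·N(A + B) = b, where N is the norm of the cubic extension) has no K(4,7).  For u, v ∈ [D]ᵐ
-- and z = (B, b) let {u, v, z} be an edge when ⟨u, v⟩ = r and the vertex encoding u + v is joined
-- to z.  If u + v = u′ + v′, then ⟨u, v′⟩ + ⟨u′, v⟩ - ⟨u, v⟩ - ⟨u′, v′⟩ = |u - u′|², so on a 2 × 2
-- grid of pairs with inner product r the sums are distinct, and a K(2,2,7) would give a K(4,7).
-- With p ≈ n^(1/4), a large constant m, (2D)ᵐ ≈ p⁴ and the most popular r, only a factor
-- O(D²) = n^O(1/m) is lost against n^(11/4).  Primes p close enough to n^(1/4) exist since the
-- common multiples of 1, …, M are at least 2^(M-1).

module Submission where

open import Defs
open import Algebra.Bundles using (RawRing; CommutativeRing)
open import Algebra.Structures using (IsCommutativeRing)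
import Algebra.Solver.Ring
open import Algebra.Solver.Ring.AlmostCommutativeRing using (fromCommutativeRing; _-Raw-AlmostCommutative⟶_)
open import Data.Bool.Base using (Bool; true; false; _∧_)
open import Data.Bool.Properties using (∧-conicalˡ; ∧-conicalʳ)
open import Data.Empty using (⊥)
open import Data.Fin.Base
  using (Fin; zero; suc; toℕ; fromℕ<; inject₁; inject≤; punchOut; combine; remQuot; finToFun; funToFin; _↑ˡ_; _↑ʳ_)
open import Data.Fin.Patterns using (0F; 1F; 2F; 3F)
open import Data.Fin.Properties
  using (_≟_; suc-injective; toℕ-injective; toℕ<n; toℕ-fromℕ<; inject₁-injective; inject≤-injective; injective⇒≤;
         punchOut-injective; ¬∀⟶∃¬; any?; remQuot-combine; combine-remQuot; funToFin-finToFin; finToFun-funToFin)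
open import Data.Fin.Subset using (Subset; _∈_; ∣_∣; ⁅_⁆)
open import Data.Fin.Subset.Properties using (∣⁅x⁆∣≡1; x∈⁅y⁆⇒x≡y)
open import Data.Integer.Base as ℤ using (ℤ; +_; -[1+_])
open import Data.Integer.Divisibility.Signed
  using (∣ᵤ⇒∣; ∣⇒∣ᵤ; ∣m∣n⇒∣m+n; ∣m∣n⇒∣m-n; ∣n⇒∣m*n; ∣m⇒∣m*n)
  renaming (_∣_ to _∣ℤ_; divides to dividesℤ; _∣?_ to _∣ℤ?_)
open import Data.Integer.DivMod using (_%ℕ_; _/ℕ_; a≡a%ℕn+[a/ℕn]*n; n%ℕd<d)
import Data.Integer.Properties as ℤₚ
open import Data.Integer.Solver renaming (module +-*-Solver to ℤ-Solver)
open import Data.List.Base using ([]; _∷_)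
open import Data.List.Relation.Unary.All using (_∷_)
import Data.Maybe.Base as Maybe
open import Data.Nat.Base as ℕ using (ℕ; zero; suc)
open import Data.Nat.Coprimality using (prime⇒coprime; coprime-Bézout)
open import Data.Nat.Divisibility as ℕ∣
  using (_∣_; divides; _∣?_; ∣⇒≤; >⇒∤; ∣-refl; ∣-reflexive; ∣-trans; ∣m+n∣m⇒∣n; *-pres-∣; *-monoʳ-∣; m∣m*n; n∣m*n; 1∣_; _∣0)
open import Data.Nat.DivMod using (m≡m%n+[m/n]*n; m%n<n; m/n*n≤m)
open import Data.Nat.GCD using (module Bézout)
open import Data.Nat.ListAction using (product)
open import Data.Nat.Primality using (Prime; prime?; euclidsLemma; prime⇒nonZero; prime⇒nonTrivial; ¬prime[1])
open import Data.Nat.Primality.Factorisation using (PrimeFactorisation; factorise)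
import Data.Nat.Properties as ℕₚ
open import Data.Nat.Solver renaming (module +-*-Solver to ℕ-Solver)
open import Data.Product.Base using (Σ; ∃-syntax; _×_; _,_; proj₁; proj₂)
open import Data.Rational.Unnormalised.Base using (mkℚᵘ; *<*; _/_)
open import Data.Sum.Base as Sum using (_⊎_; inj₁; inj₂; [_,_]′)
open import Data.Vec.Base using ([]; _∷_; lookup; tabulate; here; there)
open import Data.Vec.N-ary using (N-ary)
open import Data.Vec.Properties using ([]=⇒lookup; lookup⇒[]=; lookup∘tabulate)
open import Function.Base using (_∘_; id)
open import Level using (0ℓ)
open import Relation.Binary.PropositionalEquality
  using (_≡_; _≢_; refl; sym; trans; cong; cong₂; subst; subst₂; isEquivalence; module ≡-Reasoning)
open import Relation.Nullary.Decidable using (Dec; yes; no; ⌊_⌋; _×-dec_; dec⇒maybe)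
open import Relation.Nullary.Negation using (¬_; contradiction)
open import Relation.Unary using (Decidable)

-- The cubic order

-- There are up to n² pairs (u, v) but at most n vertices of the norm graph to encode them, so no
-- injective encoding exists. Injectivity on 2 × 2 grids is all that a K(2,2,7) can test, and fixing
-- the inner product buys exactly that. The exponent then comes from the density of the graph: each
-- vertex is joined to a fraction 1/p ≈ n^(-1/4) of the other side.
--
-- The number 7 is 3! + 1. Four vertices with common neighbours give three equations between norms,
-- once the label b is eliminated. The three conjugates of the unknown are treated as independent
-- variables, and such a system has at most six solutions; here this is shown by determinants and a
-- polynomial of degree 6 in one variable.
--
-- The obstacle is a uniform model of the field with p³ elements together with its conjugation. A
-- cyclic family of cubics over ℤ has a conjugation σ given by an integral formula, so all facts
-- about norms and conjugates are polynomial identities in a and the coordinates. Only the absence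
-- of roots modulo p depends on p, and for each p some member of the family has none.

record Triple (A : Set) : Set where
  constructor ⟨_,_,_⟩
  field c₀ c₁ c₂ : A
open Triple using (c₀; c₁; c₂)

-- ℤ[t]/(f) for Shanks' simplest cubic f(t) = t³ - at² - (a+3)t - 1, an element being the
-- triple of its coefficients.  The operations are parameters, so that they apply both to ℤ and to
-- the symbolic expressions of the ring solver.  If t is a root of f, then so is σ(t) = -1/(1+t) = t² - (a+1)t - 2.
module CubicOps {A : Set} (_+_ _*_ : A → A → A) (-_ : A → A) (con : ℤ → A) (a : A) where
  infixl 6 _⊞_
  infixl 7 _⊠_
  _⊞_ : Triple A → Triple A → Triple A
  x ⊞ y = ⟨ c₀ x + c₀ y , c₁ x + c₁ y , c₂ x + c₂ y ⟩
  ⊟_ : Triple A → Triple A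
  ⊟ x = ⟨ - c₀ x , - c₁ x , - c₂ x ⟩
  embed : A → Triple A
  embed n = ⟨ n , con (+ 0) , con (+ 0) ⟩
  -- The element d₀ + d₁t + ... + d₄t⁴, by t³ = at² + (a+3)t + 1 and hence t⁴ = (a²+a+3)t² +
  -- (a²+3a+1)t + a.
  reduce : A → A → A → A → A → Triple A
  reduce d₀ d₁ d₂ d₃ d₄ =
    ⟨ d₀ + (d₃ + (a * d₄))
    , d₁ + (((a + con (+ 3)) * d₃) + (((a * (a + con (+ 3))) + con (+ 1)) * d₄))
    , d₂ + ((a * d₃) + (((a * a) + (a + con (+ 3))) * d₄)) ⟩
  _⊠_ : Triple A → Triple A → Triple A
  x ⊠ y = reduce (c₀ x * c₀ y) ((c₀ x * c₁ y) + (c₁ x * c₀ y))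
    ((c₀ x * c₂ y) + ((c₁ x * c₁ y) + (c₂ x * c₀ y)))
    ((c₁ x * c₂ y) + (c₂ x * c₁ y)) (c₂ x * c₂ y)
  -- The substitution t ↦ t² - (a+1)t - 2 on the basis 1, t, t²; the coefficients of `c₂ x` come
  -- from σ(t)² = at² - (a²+a+1)t + 2 - a.
  σ : Triple A → Triple A
  σ x = ⟨ c₀ x + ((con -[1+ 1 ] * c₁ x) + ((con (+ 2) + (- a)) * c₂ x))
        , - (((a + con (+ 1)) * c₁ x) + (((a * a) + (a + con (+ 1))) * c₂ x))
        , c₁ x + (a * c₂ x) ⟩
  -- The constant coefficient is the whole product of the conjugates: the other two vanish by
  -- `embed-norm`.
  norm : Triple A → A
  norm x = c₀ (x ⊠ (σ x ⊠ σ (σ x)))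

≡-triple : ∀ {A} {x y : Triple A} → c₀ x ≡ c₀ y → c₁ x ≡ c₁ y → c₂ x ≡ c₂ y → x ≡ y
≡-triple refl refl refl = refl

module CubicOrder (a : ℤ) where
  open ℤ-Solver
  private module Ops = CubicOps ℤ._+_ ℤ._*_ ℤ.-_ (λ n → n) a
  open Ops public using (_⊞_; ⊟_; embed)

  Order : Set
  Order = Triple ℤ

  infixl 7 _⊠_
  opaque
    _⊠_ : Order → Order → Order
    _⊠_ = Ops._⊠_
    σ : Order → Order
    σ = Ops.σ
    norm : Order → ℤ
    norm = Ops.norm

  private module Sym {n} = CubicOps {Polynomial n} _:+_ _:*_ :-_ con

  cubic : ℤ → ℤ
  cubic τ = (τ ℤ.* (τ ℤ.* τ)) ℤ.- (a ℤ.* (τ ℤ.* τ) ℤ.+ ((a ℤ.+ + 3) ℤ.* τ ℤ.+ + 1))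

  opaque
    unfolding _⊠_ σ norm

    ⊠-assoc : ∀ x y z → (x ⊠ y) ⊠ z ≡ x ⊠ (y ⊠ z)
    ⊠-assoc ⟨ x₀ , x₁ , x₂ ⟩ ⟨ y₀ , y₁ , y₂ ⟩ ⟨ z₀ , z₁ , z₂ ⟩ = ≡-triple
      (solve 10 (eqn c₀) refl a x₀ x₁ x₂ y₀ y₁ y₂ z₀ z₁ z₂)
      (solve 10 (eqn c₁) refl a x₀ x₁ x₂ y₀ y₁ y₂ z₀ z₁ z₂)
      (solve 10 (eqn c₂) refl a x₀ x₁ x₂ y₀ y₁ y₂ z₀ z₁ z₂)
      where
      eqn : (Triple (Polynomial 10) → Polynomial 10) → N-ary 10 (Polynomial 10) (Polynomial 10 × Polynomial 10)
      eqn c a x₀ x₁ x₂ y₀ y₁ y₂ z₀ z₁ z₂ =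
        let x = ⟨ x₀ , x₁ , x₂ ⟩ ; y = ⟨ y₀ , y₁ , y₂ ⟩ ; z = ⟨ z₀ , z₁ , z₂ ⟩
            infixl 7 _·_
            _·_ = Sym._⊠_ a
        in c ((x · y) · z) := c (x · (y · z))

    ⊠-distribʳ-⊞ : ∀ x y z → (y ⊞ z) ⊠ x ≡ (y ⊠ x) ⊞ (z ⊠ x)
    ⊠-distribʳ-⊞ ⟨ x₀ , x₁ , x₂ ⟩ ⟨ y₀ , y₁ , y₂ ⟩ ⟨ z₀ , z₁ , z₂ ⟩ = ≡-triple
      (solve 10 (eqn c₀) refl a x₀ x₁ x₂ y₀ y₁ y₂ z₀ z₁ z₂)
      (solve 10 (eqn c₁) refl a x₀ x₁ x₂ y₀ y₁ y₂ z₀ z₁ z₂)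
      (solve 10 (eqn c₂) refl a x₀ x₁ x₂ y₀ y₁ y₂ z₀ z₁ z₂)
      where
      eqn : (Triple (Polynomial 10) → Polynomial 10) → N-ary 10 (Polynomial 10) (Polynomial 10 × Polynomial 10)
      eqn c a x₀ x₁ x₂ y₀ y₁ y₂ z₀ z₁ z₂ =
        let x = ⟨ x₀ , x₁ , x₂ ⟩ ; y = ⟨ y₀ , y₁ , y₂ ⟩ ; z = ⟨ z₀ , z₁ , z₂ ⟩
            _·_ = Sym._⊠_ a ; _∔_ = Sym._⊞_ a
        in c ((y ∔ z) · x) := c ((y · x) ∔ (z · x))

    ⊠-comm : ∀ x y → x ⊠ y ≡ y ⊠ x
    ⊠-comm ⟨ x₀ , x₁ , x₂ ⟩ ⟨ y₀ , y₁ , y₂ ⟩ = ≡-triple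
      (solve 7 (eqn c₀) refl a x₀ x₁ x₂ y₀ y₁ y₂)
      (solve 7 (eqn c₁) refl a x₀ x₁ x₂ y₀ y₁ y₂)
      (solve 7 (eqn c₂) refl a x₀ x₁ x₂ y₀ y₁ y₂)
      where
      eqn : (Triple (Polynomial 7) → Polynomial 7) → N-ary 7 (Polynomial 7) (Polynomial 7 × Polynomial 7)
      eqn c a x₀ x₁ x₂ y₀ y₁ y₂ =
        let x = ⟨ x₀ , x₁ , x₂ ⟩ ; y = ⟨ y₀ , y₁ , y₂ ⟩
            _·_ = Sym._⊠_ a
        in c (x · y) := c (y · x)

    σ-⊠ : ∀ x y → σ (x ⊠ y) ≡ σ x ⊠ σ y
    σ-⊠ ⟨ x₀ , x₁ , x₂ ⟩ ⟨ y₀ , y₁ , y₂ ⟩ = ≡-triple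
      (solve 7 (eqn c₀) refl a x₀ x₁ x₂ y₀ y₁ y₂)
      (solve 7 (eqn c₁) refl a x₀ x₁ x₂ y₀ y₁ y₂)
      (solve 7 (eqn c₂) refl a x₀ x₁ x₂ y₀ y₁ y₂)
      where
      eqn : (Triple (Polynomial 7) → Polynomial 7) → N-ary 7 (Polynomial 7) (Polynomial 7 × Polynomial 7)
      eqn c a x₀ x₁ x₂ y₀ y₁ y₂ =
        let x = ⟨ x₀ , x₁ , x₂ ⟩ ; y = ⟨ y₀ , y₁ , y₂ ⟩
            _·_ = Sym._⊠_ a ; s = Sym.σ a
        in c (s (x · y)) := c (s x · s y)

    σ-⊞ : ∀ x y → σ (x ⊞ y) ≡ σ x ⊞ σ y
    σ-⊞ ⟨ x₀ , x₁ , x₂ ⟩ ⟨ y₀ , y₁ , y₂ ⟩ = ≡-triple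
      (solve 7 (eqn c₀) refl a x₀ x₁ x₂ y₀ y₁ y₂)
      (solve 7 (eqn c₁) refl a x₀ x₁ x₂ y₀ y₁ y₂)
      (solve 7 (eqn c₂) refl a x₀ x₁ x₂ y₀ y₁ y₂)
      where
      eqn : (Triple (Polynomial 7) → Polynomial 7) → N-ary 7 (Polynomial 7) (Polynomial 7 × Polynomial 7)
      eqn c a x₀ x₁ x₂ y₀ y₁ y₂ =
        let x = ⟨ x₀ , x₁ , x₂ ⟩ ; y = ⟨ y₀ , y₁ , y₂ ⟩
            _∔_ = Sym._⊞_ a ; s = Sym.σ a
        in c (s (x ∔ y)) := c (s x ∔ s y)

    σ-embed : ∀ n → σ (embed n) ≡ embed n
    σ-embed n = ≡-triple
      (solve 2 (λ a n → c₀ (Sym.σ a (Sym.embed a n)) := n) refl a n)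
      (solve 2 (λ a n → c₁ (Sym.σ a (Sym.embed a n)) := con (+ 0)) refl a n)
      (solve 2 (λ a n → c₂ (Sym.σ a (Sym.embed a n)) := con (+ 0)) refl a n)

    σ-⊟ : ∀ x → σ (⊟ x) ≡ ⊟ σ x
    σ-⊟ ⟨ x₀ , x₁ , x₂ ⟩ = ≡-triple
      (solve 4 (eqn c₀) refl a x₀ x₁ x₂)
      (solve 4 (eqn c₁) refl a x₀ x₁ x₂)
      (solve 4 (eqn c₂) refl a x₀ x₁ x₂)
      where
      eqn : (Triple (Polynomial 4) → Polynomial 4) → N-ary 4 (Polynomial 4) (Polynomial 4 × Polynomial 4)
      eqn c a x₀ x₁ x₂ = let x = ⟨ x₀ , x₁ , x₂ ⟩ in c (Sym.σ a (Sym.⊟_ a x)) := c (Sym.⊟_ a (Sym.σ a x))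

    embed-⊠ : ∀ m x → embed m ⊠ x ≡ ⟨ m ℤ.* c₀ x , m ℤ.* c₁ x , m ℤ.* c₂ x ⟩
    embed-⊠ m ⟨ x₀ , x₁ , x₂ ⟩ = ≡-triple
      (solve 5 (eqn c₀ c₀) refl a m x₀ x₁ x₂)
      (solve 5 (eqn c₁ c₁) refl a m x₀ x₁ x₂)
      (solve 5 (eqn c₂ c₂) refl a m x₀ x₁ x₂)
      where
      eqn : (c c′ : Triple (Polynomial 5) → Polynomial 5) → N-ary 5 (Polynomial 5) (Polynomial 5 × Polynomial 5)
      eqn c c′ a m x₀ x₁ x₂ = c (Sym._⊠_ a (Sym.embed a m) ⟨ x₀ , x₁ , x₂ ⟩) := m :* c′ ⟨ x₀ , x₁ , x₂ ⟩

    embed-norm : ∀ x → embed (norm x) ≡ x ⊠ (σ x ⊠ σ (σ x))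
    embed-norm ⟨ x₀ , x₁ , x₂ ⟩ = ≡-triple refl
      (solve 4 (eqn c₁) refl a x₀ x₁ x₂)
      (solve 4 (eqn c₂) refl a x₀ x₁ x₂)
      where
      eqn : (Triple (Polynomial 4) → Polynomial 4) → N-ary 4 (Polynomial 4) (Polynomial 4 × Polynomial 4)
      eqn c a x₀ x₁ x₂ =
        let x = ⟨ x₀ , x₁ , x₂ ⟩
            _·_ = Sym._⊠_ a ; s = Sym.σ a
        in con (+ 0) := c (x · (s x · s (s x)))

    -- The right side is -x₁³ f(-x₀/x₁) with denominators cleared, which ties zeros of the norm on
    -- linear elements to roots of f.
    norm-linear : ∀ x₀ x₁ → norm ⟨ x₀ , x₁ , + 0 ⟩ ≡
      x₀ ℤ.* (x₀ ℤ.* x₀) ℤ.+ x₁ ℤ.* (a ℤ.* (x₀ ℤ.* x₀) ℤ.+ x₁ ℤ.* (x₁ ℤ.- (a ℤ.+ + 3) ℤ.* x₀))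
    norm-linear = solve 3 (λ a x₀ x₁ →
        Sym.norm a ⟨ x₀ , x₁ , con (+ 0) ⟩ :=
        x₀ :* (x₀ :* x₀) :+ x₁ :* (a :* (x₀ :* x₀) :+ x₁ :* (x₁ :- (a :+ con (+ 3)) :* x₀)))
      refl a

    -- The second factor is the quotient in the division of x₂² f by x. Since f = 0 in the order,
    -- the product is minus the remainder, which has degree at most 1.
    ⊠-linear : ∀ x₀ x₁ x₂ → c₂ (⟨ x₀ , x₁ , x₂ ⟩ ⊠ ⟨ ℤ.- (a ℤ.* x₂ ℤ.+ x₁) , x₂ , + 0 ⟩) ≡ + 0
    ⊠-linear = solve 4 (λ a x₀ x₁ x₂ →
        c₂ (Sym._⊠_ a ⟨ x₀ , x₁ , x₂ ⟩ ⟨ :- (a :* x₂ :+ x₁) , x₂ , con (+ 0) ⟩) := con (+ 0))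
      refl a

-- Polynomial functions and elimination

ℤ-rawRing : RawRing 0ℓ 0ℓ
ℤ-rawRing = CommutativeRing.rawRing ℤₚ.+-*-commutativeRing

-- If a w + b u + c v + e = 0 in each coordinate, Cramer's rule expresses w, u, v through 3×3
-- determinants; the resultant is what is left of the relation w = u v.
module Determinant {A : Set} (_+_ _*_ : A → A → A) (-_ : A → A) where
  open Triple
  dot : Triple A → Triple A → A
  dot x y = (c₀ x * c₀ y) + ((c₁ x * c₁ y) + (c₂ x * c₂ y))
  minor : A → A → A → A → A
  minor x y z w = (x * w) + (- (y * z))
  cross : Triple A → Triple A → Triple A
  cross x y =
    ⟨ minor (c₁ x) (c₂ x) (c₁ y) (c₂ y)
    , minor (c₂ x) (c₀ x) (c₂ y) (c₀ y)
    , minor (c₀ x) (c₁ x) (c₀ y) (c₁ y) ⟩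
  det : Triple A → Triple A → Triple A → A
  det x y z = dot x (cross y z)
  resultant : Triple A → Triple A → Triple A → Triple A → A
  resultant a b c e = (det a b c * det e b c) + (det a e c * det a b e)

module PolynomialFunctions (R : CommutativeRing 0ℓ 0ℓ)
  (fromℤ : ℤ-rawRing -Raw-AlmostCommutative⟶ fromCommutativeRing R) where

  open CommutativeRing R hiding (zero) renaming (refl to ≈-refl; sym to ≈-sym; trans to ≈-trans; reflexive to ≈-reflexive)
  open Algebra.Solver.Ring ℤ-rawRing (fromCommutativeRing R) fromℤ
    (λ m n → Maybe.map (≈-reflexive ∘ cong (_-Raw-AlmostCommutative⟶_.⟦_⟧ fromℤ)) (dec⇒maybe (m ℤₚ.≟ n)))

  -- Polynomial functions of degree ≤ d, as those whose d-th divided differences are constant.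
  data Poly : ℕ → (Carrier → Carrier) → Set where
    constant : ∀ {f} → (∀ x y → f x ≈ f y) → Poly 0 f
    quotient : ∀ {d f} → (∀ r → Σ (Carrier → Carrier) λ g → Poly d g × (∀ x → f x ≈ f r + (x - r) * g x)) →
               Poly (suc d) f

  poly-const : ∀ c → Poly 0 (λ _ → c)
  poly-const c = constant λ _ _ → ≈-refl

  poly-suc : ∀ {d f} → Poly d f → Poly (suc d) f
  poly-suc (constant f-const) = quotient λ r → (λ _ → 0#) , poly-const 0# , λ x →
    ≈-trans (f-const x r) (≈-trans (≈-sym (+-identityʳ _)) (+-congˡ (≈-sym (zeroʳ _))))
  poly-suc (quotient q) = quotient λ r → let g , G , eq = q r in g , poly-suc G , eq

  poly-raise : ∀ k {d f} → Poly d f → Poly (k ℕ.+ d) f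
  poly-raise zero    P = P
  poly-raise (suc k) P = poly-suc (poly-raise k P)

  poly-id : Poly 1 (λ x → x)
  poly-id = quotient λ r → (λ _ → 1#) , poly-const 1# , λ x →
    ≈-trans (solve 2 (λ x r → x := r :+ (x :- r)) ≈-refl x r) (+-congˡ (≈-sym (*-identityʳ _)))

  poly-+ : ∀ {d f h} → Poly d f → Poly d h → Poly d (λ x → f x + h x)
  poly-+ (constant f-const) (constant h-const) = constant λ x y → +-cong (f-const x y) (h-const x y)
  poly-+ {f = f} {h} (quotient p) (quotient q) = quotient λ r →
    let g  , G  , eq  = p r
        g′ , G′ , eq′ = q r
    in (λ x → g x + g′ x) , poly-+ G G′ , λ x → ≈-trans (+-cong (eq x) (eq′ x))
      (solve 6 (λ f h x r g g′ →
          (f :+ (x :- r) :* g) :+ (h :+ (x :- r) :* g′) := (f :+ h) :+ (x :- r) :* (g :+ g′))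
        ≈-refl (f r) (h r) x r (g x) (g′ x))

  poly-neg : ∀ {d f} → Poly d f → Poly d (λ x → - f x)
  poly-neg (constant f-const) = constant λ x y → -‿cong (f-const x y)
  poly-neg {f = f} (quotient q) = quotient λ r →
    let g , G , eq = q r
    in (λ x → - g x) , poly-neg G , λ x → ≈-trans (-‿cong (eq x))
      (solve 4 (λ f x r g → :- (f :+ (x :- r) :* g) := :- f :+ (x :- r) :* :- g) ≈-refl (f r) x r (g x))

  poly-scale : ∀ {e} {f h : Carrier → Carrier} → (∀ x y → f x ≈ f y) → Poly e h → Poly e (λ x → f x * h x)
  poly-scale f-const (constant h-const) = constant λ x y → *-cong (f-const x y) (h-const x y)
  poly-scale {f = f} {h} f-const (quotient q) = quotient λ r →
    let g , G , eq = q r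
    in (λ x → f x * g x) , poly-scale f-const G , λ x → ≈-trans (*-congˡ (eq x)) (≈-trans
      (solve 5 (λ f h x r g → f :* (h :+ (x :- r) :* g) := f :* h :+ (x :- r) :* (f :* g)) ≈-refl (f x) (h r) x r (g x))
      (+-congʳ (*-congʳ (f-const x r))))

  poly-* : ∀ {d e f h} → Poly d f → Poly e h → Poly (d ℕ.+ e) (λ x → f x * h x)
  poly-* (constant f-const) Q = poly-scale f-const Q
  poly-* {f = f} {h} (quotient p) (constant h-const) = quotient λ r →
    let g , G , eq = p r
    in (λ x → g x * h x) , poly-* G (constant h-const) , λ x → ≈-trans (*-congʳ (eq x)) (≈-trans
      (solve 5 (λ f h x r g → (f :+ (x :- r) :* g) :* h := f :* h :+ (x :- r) :* (g :* h)) ≈-refl (f r) (h x) x r (g x))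
      (+-congʳ (*-congˡ (h-const x r))))
  poly-* {suc d} {suc e} {f} {h} (quotient p) (quotient q) = quotient λ r →
    let g  , G  , eq  = p r
        g′ , G′ , eq′ = q r
    in (λ x → g x * h x + f r * g′ x)
     -- Product rule for divided differences. As f r is a constant, the second summand only has
     -- degree e and is raised to the bound of the first.
     , poly-+ (poly-* G (quotient q)) (poly-raise d (poly-suc (poly-scale {f = λ _ → f r} (λ _ _ → ≈-refl) G′)))
     , λ x → ≈-trans (*-congʳ (eq x)) (≈-trans
         (solve 5 (λ f x r g h → (f :+ (x :- r) :* g) :* h := f :* h :+ (x :- r) :* (g :* h)) ≈-refl (f r) x r (g x) (h x))
         (≈-trans (+-congʳ (*-congˡ (eq′ x)))
           (solve 7 (λ f k x r g h g′ →
               f :* (k :+ (x :- r) :* g′) :+ (x :- r) :* (g :* h) := f :* k :+ (x :- r) :* (g :* h :+ f :* g′))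
             ≈-refl (f r) (h r) x r (g x) (h x) (g′ x))))

  open Determinant _+_ _*_ -_ public

  column : (Fin 3 → Carrier) → Triple Carrier
  column x = ⟨ x 0F , x 1F , x 2F ⟩

  private module Sym {n} = Determinant {Polynomial n} _:+_ _:*_ :-_

  poly-det : ∀ {a₀ a₁ a₂ b₀ b₁ b₂ c₀ c₁ c₂ : Carrier → Carrier} →
    Poly 1 a₀ → Poly 1 a₁ → Poly 1 a₂ → Poly 1 b₀ → Poly 1 b₁ → Poly 1 b₂ → Poly 1 c₀ → Poly 1 c₁ → Poly 1 c₂ →
    Poly 3 (λ x → det ⟨ a₀ x , a₁ x , a₂ x ⟩ ⟨ b₀ x , b₁ x , b₂ x ⟩ ⟨ c₀ x , c₁ x , c₂ x ⟩)
  poly-det A₀ A₁ A₂ B₀ B₁ B₂ C₀ C₁ C₂ =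
    poly-+ (poly-* A₀ (poly-minor B₁ B₂ C₁ C₂)) (poly-+ (poly-* A₁ (poly-minor B₂ B₀ C₂ C₀)) (poly-* A₂ (poly-minor B₀ B₁ C₀ C₁)))
    where
    poly-minor : ∀ {x y z w : Carrier → Carrier} → Poly 1 x → Poly 1 y → Poly 1 z → Poly 1 w →
      Poly 2 (λ t → minor (x t) (y t) (z t) (w t))
    poly-minor X Y Z W = poly-+ (poly-* X W) (poly-neg (poly-* Y Z))

  *-interchange₃ : ∀ x y x′ y′ x″ y″ → (x * y) * ((x′ * y′) * (x″ * y″)) ≈ (x * (x′ * x″)) * (y * (y′ * y″))
  *-interchange₃ = solve 6 (λ x y x′ y′ x″ y″ →
    (x :* y) :* ((x′ :* y′) :* (x″ :* y″)) := (x :* (x′ :* x″)) :* (y :* (y′ :* y″))) ≈-refl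

  [z+x]-[z+y]≈x-y : ∀ x y z → (z + x) - (z + y) ≈ x - y
  [z+x]-[z+y]≈x-y = solve 3 (λ x y z → (z :+ x) :- (z :+ y) := x :- y) ≈-refl

  [x+z]-[y+z]≈x-y : ∀ x y z → (x + z) - (y + z) ≈ x - y
  [x+z]-[y+z]≈x-y = solve 3 (λ x y z → (x :+ z) :- (y :+ z) := x :- y) ≈-refl

  [y+z]+[x-y]≈x+z : ∀ x y z → (y + z) + (x - y) ≈ x + z
  [y+z]+[x-y]≈x+z = solve 3 (λ x y z → (y :+ z) :+ (x :- y) := x :+ z) ≈-refl

  [x-z]-[y-z]≈x-y : ∀ x y z → (x - z) - (y - z) ≈ x - y
  [x-z]-[y-z]≈x-y = solve 3 (λ x y z → (x :- z) :- (y :- z) := x :- y) ≈-refl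

  private
    row : (a b c e w u v : Carrier) → Carrier
    row a b c e w u v = a * w + b * u + c * v + e
    rowˢ : ∀ {n} (a b c e w u v : Polynomial n) → Polynomial n
    rowˢ a b c e w u v = a :* w :+ b :* u :+ c :* v :+ e

  module _ (a₀ a₁ a₂ b₀ b₁ b₂ c₀ c₁ c₂ e₀ e₁ e₂ w u v : Carrier) where
    private
      a b c e rows : Triple Carrier
      a = ⟨ a₀ , a₁ , a₂ ⟩ ; b = ⟨ b₀ , b₁ , b₂ ⟩ ; c = ⟨ c₀ , c₁ , c₂ ⟩ ; e = ⟨ e₀ , e₁ , e₂ ⟩
      rows = ⟨ row a₀ b₀ c₀ e₀ w u v , row a₁ b₁ c₁ e₁ w u v , row a₂ b₂ c₂ e₂ w u v ⟩

    cramer₁ : det a b c * w + det e b c ≈ dot rows (cross b c)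
    cramer₁ = solve 15 (λ a₀ a₁ a₂ b₀ b₁ b₂ c₀ c₁ c₂ e₀ e₁ e₂ w u v →
       let a = ⟨ a₀ , a₁ , a₂ ⟩ ; b = ⟨ b₀ , b₁ , b₂ ⟩ ; c = ⟨ c₀ , c₁ , c₂ ⟩ ; e = ⟨ e₀ , e₁ , e₂ ⟩
           rows = ⟨ rowˢ a₀ b₀ c₀ e₀ w u v , rowˢ a₁ b₁ c₁ e₁ w u v , rowˢ a₂ b₂ c₂ e₂ w u v ⟩
       in Sym.det a b c :* w :+ Sym.det e b c := Sym.dot rows (Sym.cross b c))
      ≈-refl a₀ a₁ a₂ b₀ b₁ b₂ c₀ c₁ c₂ e₀ e₁ e₂ w u v

    cramer₂ : det a b c * u + det a e c ≈ dot rows (cross c a)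
    cramer₂ = solve 15 (λ a₀ a₁ a₂ b₀ b₁ b₂ c₀ c₁ c₂ e₀ e₁ e₂ w u v →
       let a = ⟨ a₀ , a₁ , a₂ ⟩ ; b = ⟨ b₀ , b₁ , b₂ ⟩ ; c = ⟨ c₀ , c₁ , c₂ ⟩ ; e = ⟨ e₀ , e₁ , e₂ ⟩
           rows = ⟨ rowˢ a₀ b₀ c₀ e₀ w u v , rowˢ a₁ b₁ c₁ e₁ w u v , rowˢ a₂ b₂ c₂ e₂ w u v ⟩
       in Sym.det a b c :* u :+ Sym.det a e c := Sym.dot rows (Sym.cross c a))
      ≈-refl a₀ a₁ a₂ b₀ b₁ b₂ c₀ c₁ c₂ e₀ e₁ e₂ w u v

    cramer₃ : det a b c * v + det a b e ≈ dot rows (cross a b)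
    cramer₃ = solve 15 (λ a₀ a₁ a₂ b₀ b₁ b₂ c₀ c₁ c₂ e₀ e₁ e₂ w u v →
       let a = ⟨ a₀ , a₁ , a₂ ⟩ ; b = ⟨ b₀ , b₁ , b₂ ⟩ ; c = ⟨ c₀ , c₁ , c₂ ⟩ ; e = ⟨ e₀ , e₁ , e₂ ⟩
           rows = ⟨ rowˢ a₀ b₀ c₀ e₀ w u v , rowˢ a₁ b₁ c₁ e₁ w u v , rowˢ a₂ b₂ c₂ e₂ w u v ⟩
       in Sym.det a b c :* v :+ Sym.det a b e := Sym.dot rows (Sym.cross a b))
      ≈-refl a₀ a₁ a₂ b₀ b₁ b₂ c₀ c₁ c₂ e₀ e₁ e₂ w u v

  module Ideal (I : Carrier → Set)
    (I-resp : ∀ {x y} → x ≈ y → I x → I y)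
    (I-+ : ∀ {x y} → I x → I y → I (x + y))
    (I-* : ∀ x {y} → I y → I (x * y)) where

    I-neg : ∀ {x} → I x → I (- x)
    I-neg p = I-resp (solve 1 (λ x → :- con (+ 1) :* x := :- x) ≈-refl _) (I-* _ p)

    I-− : ∀ {x y} → I x → I y → I (x - y)
    I-− p q = I-+ p (I-neg q)

    I-*ʳ : ∀ x {y} → I y → I (y * x)
    I-*ʳ x p = I-resp (*-comm _ _) (I-* x p)

    I-*-cong : ∀ {x x′ y y′} → I (x - x′) → I (y - y′) → I (x * y - x′ * y′)
    I-*-cong p q = I-resp
      (solve 4 (λ x x′ y y′ → (x :- x′) :* y :+ x′ :* (y :- y′) := x :* y :- x′ :* y′) ≈-refl _ _ _ _)
      (I-+ (I-*ʳ _ p) (I-* _ q))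

  module PrimeIdeal (I : Carrier → Set)
    (I-resp : ∀ {x y} → x ≈ y → I x → I y)
    (I-+ : ∀ {x y} → I x → I y → I (x + y))
    (I-* : ∀ x {y} → I y → I (x * y))
    (I-prime : ∀ {x y} → I (x * y) → I x ⊎ I y) where
    open Ideal I I-resp I-+ I-*

    ∉-* : ∀ {x y} → ¬ I x → ¬ I y → ¬ I (x * y)
    ∉-* x∉ y∉ p with I-prime p
    ... | inj₁ x∈ = x∉ x∈
    ... | inj₂ y∈ = y∉ y∈

    -- Divide out the root `r zero`. Modulo a prime ideal the factor r i - r 0 can be cancelled, so
    -- the remaining roots pass to the quotient, whose degree is one less.
    roots⇒vanishes : ∀ {d f} → Poly d f → (r : Fin (suc d) → Carrier) →
      (∀ {i j} → ¬ i ≡ j → ¬ I (r i - r j)) → (∀ i → I (f (r i))) → ∀ x → I (f x)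
    roots⇒vanishes (constant f-const) r r-distinct root x = I-resp (f-const _ x) (root zero)
    roots⇒vanishes {suc d} {f} (quotient q) r r-distinct root x =
      let g , G , eq = q (r zero)
          g-root = λ i → case-inj (I-prime (I-resp
            (≈-trans (+-congʳ (eq (r (suc i)))) (solve 2 (λ y z → y :+ z :- y := z) ≈-refl _ _))
            (I-− (root (suc i)) (root zero)))) (r-distinct {suc i} {zero} λ ())
          g-vanishes = roots⇒vanishes G (r ∘ suc) (λ i≢j → r-distinct (i≢j ∘ suc-injective)) g-root
      in I-resp (≈-sym (eq x)) (I-+ (root zero) (I-* _ (g-vanishes x)))
      where
      case-inj : ∀ {P Q : Set} → P ⊎ Q → ¬ P → Q
      case-inj (inj₁ p) ¬p = contradiction p ¬p
      case-inj (inj₂ q) _  = q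

    dot∈ : ∀ {x₀ x₁ x₂} y → I x₀ → I x₁ → I x₂ → I (dot ⟨ x₀ , x₁ , x₂ ⟩ y)
    dot∈ y p₀ p₁ p₂ = I-+ (I-*ʳ _ p₀) (I-+ (I-*ʳ _ p₁) (I-*ʳ _ p₂))

    -- The determinant D of the system may itself lie in I, so nothing is divided by it: modulo I,
    -- Cramer's rule turns D²w = (Du)(Dv) into -D D₁ = D₂ D₃.
    resultant∈ : ∀ a b c e u v →
      (∀ i → I (row (a i) (b i) (c i) (e i) (u * v) u v)) →
      I (resultant (column a) (column b) (column c) (column e))
    resultant∈ a b c e u v rows∈ = I-resp
      (solve 6 (λ D D₁ D₂ D₃ u v →
          D :* (D :* (u :* v) :+ D₁) :+ (D :* u :+ D₂) :* D₃ :- D :* u :* (D :* v :+ D₃) := D :* D₁ :+ D₂ :* D₃)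
        ≈-refl _ _ _ _ u v)
      (I-− (I-+ (I-* _ E₁) (I-*ʳ _ E₂)) (I-* _ E₃))
      where
      E = λ (y : Triple Carrier) → dot∈ y (rows∈ 0F) (rows∈ 1F) (rows∈ 2F)
      E₁ = I-resp (≈-sym (cramer₁ (a 0F) (a 1F) (a 2F) (b 0F) (b 1F) (b 2F) (c 0F) (c 1F) (c 2F) (e 0F) (e 1F) (e 2F) (u * v) u v)) (E _)
      E₂ = I-resp (≈-sym (cramer₂ (a 0F) (a 1F) (a 2F) (b 0F) (b 1F) (b 2F) (c 0F) (c 1F) (c 2F) (e 0F) (e 1F) (e 2F) (u * v) u v)) (E _)
      E₃ = I-resp (≈-sym (cramer₃ (a 0F) (a 1F) (a 2F) (b 0F) (b 1F) (b 2F) (c 0F) (c 1F) (c 2F) (e 0F) (e 1F) (e 2F) (u * v) u v)) (E _)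

    -- (z, u, v) is a root of three (1,1,1)-forms.  Eliminating u and v gives a polynomial in z of
    -- degree 6, whose value at 0 is ± ∏ (cᵢγᵢ)² ∏ (αᵢ - αⱼ)(βᵢ - βⱼ).
    ¬seven-solutions : (c α β γ : Fin 3 → Carrier) (c′ : Carrier) (z u v : Fin 7 → Carrier) →
      (∀ i → ¬ I (c i)) → (∀ i → ¬ I (γ i)) →
      (∀ {i j} → ¬ i ≡ j → ¬ I (α i - α j)) → (∀ {i j} → ¬ i ≡ j → ¬ I (β i - β j)) →
      (∀ {k l} → ¬ k ≡ l → ¬ I (z k - z l)) →
      ¬ (∀ k i → I (c i * ((z k + γ i) * ((u k + α i) * (v k + β i))) - c′ * (z k * (u k * v k))))
    ¬seven-solutions c α β γ c′ z u v c∉ γ∉ α∉ β∉ z∉ solutions =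
      resultantAt0∉ (roots⇒vanishes resultantAt-poly z z∉ resultantAt-root 0ᶻ)
      where
      0ᶻ : Carrier
      0ᶻ = _-Raw-AlmostCommutative⟶_.⟦_⟧ fromℤ (+ 0)

      P A B C E : Carrier → Fin 3 → Carrier
      P x i = c i * (x + γ i)
      -- `A`, `B`, `C`, `E` are the coefficients of uv, u, v and 1 in c(x + γ)(u + α)(v + β) -
      -- c′xuv; each has degree at most 1 in x.
      A x i = P x i - c′ * x
      B x i = P x i * β i
      C x i = P x i * α i
      E x i = P x i * (α i * β i)

      resultantAt : Carrier → Carrier
      resultantAt x = resultant (column (A x)) (column (B x)) (column (C x)) (column (E x))

      P-poly : ∀ i → Poly 1 (λ x → P x i)
      P-poly i = poly-* (poly-const (c i)) (poly-+ poly-id (poly-suc (poly-const (γ i))))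
      A-poly : ∀ i → Poly 1 (λ x → A x i)
      A-poly i = poly-+ (P-poly i) (poly-neg (poly-* (poly-const c′) poly-id))
      B-poly : ∀ i → Poly 1 (λ x → B x i)
      B-poly i = poly-* (P-poly i) (poly-const (β i))
      C-poly : ∀ i → Poly 1 (λ x → C x i)
      C-poly i = poly-* (P-poly i) (poly-const (α i))
      E-poly : ∀ i → Poly 1 (λ x → E x i)
      E-poly i = poly-* (P-poly i) (poly-const (α i * β i))

      resultantAt-poly : Poly 6 resultantAt
      resultantAt-poly = poly-+
        (poly-* (poly-det (A-poly 0F) (A-poly 1F) (A-poly 2F) (B-poly 0F) (B-poly 1F) (B-poly 2F) (C-poly 0F) (C-poly 1F) (C-poly 2F))
                (poly-det (E-poly 0F) (E-poly 1F) (E-poly 2F) (B-poly 0F) (B-poly 1F) (B-poly 2F) (C-poly 0F) (C-poly 1F) (C-poly 2F)))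
        (poly-* (poly-det (A-poly 0F) (A-poly 1F) (A-poly 2F) (E-poly 0F) (E-poly 1F) (E-poly 2F) (C-poly 0F) (C-poly 1F) (C-poly 2F))
                (poly-det (A-poly 0F) (A-poly 1F) (A-poly 2F) (B-poly 0F) (B-poly 1F) (B-poly 2F) (E-poly 0F) (E-poly 1F) (E-poly 2F)))

      resultantAt-root : ∀ k → I (resultantAt (z k))
      resultantAt-root k = resultant∈ (A (z k)) (B (z k)) (C (z k)) (E (z k)) (u k) (v k) λ i → I-resp
        (solve 8 (λ c α β γ c′ z u v →
            c :* ((z :+ γ) :* ((u :+ α) :* (v :+ β))) :- c′ :* (z :* (u :* v)) :=
            rowˢ (c :* (z :+ γ) :- c′ :* z) (c :* (z :+ γ) :* β) (c :* (z :+ γ) :* α) (c :* (z :+ γ) :* (α :* β)) (u :* v) u v)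
          ≈-refl (c i) (α i) (β i) (γ i) c′ (z k) (u k) (v k))
        (solutions k i)

      -- At x = 0 the system reads cᵢγᵢ(u + αᵢ)(v + βᵢ) = 0 for three values of i. By pigeonhole a
      -- solution would need two equal αᵢ or two equal βᵢ, which is what the factors of the
      -- resultant in `resultantAt0` express.
      resultantAt0∉ : ¬ I (resultantAt 0ᶻ)
      resultantAt0∉ p = ∉-* (∉-* (∉-sq (c∉ 0F) (γ∉ 0F)) (∉-* (∉-sq (c∉ 1F) (γ∉ 1F)) (∉-sq (c∉ 2F) (γ∉ 2F))))
          (∉-* (∉-* (α∉ 1≢0) (∉-* (α∉ 0≢2) (α∉ 1≢2))) (∉-* (β∉ 0≢1) (∉-* (β∉ 0≢2) (β∉ 1≢2))))
          (I-resp (resultantAt0 (c 0F) (c 1F) (c 2F) (γ 0F) (γ 1F) (γ 2F) (α 0F) (α 1F) (α 2F) (β 0F) (β 1F) (β 2F)) p)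
        where
        0≢1 : ¬ 0F ≡ 1F
        0≢1 ()
        1≢0 : ¬ 1F ≡ 0F
        1≢0 ()
        0≢2 : ¬ 0F ≡ 2F
        0≢2 ()
        1≢2 : ¬ 1F ≡ 2F
        1≢2 ()
        ∉-sq : ∀ {x y} → ¬ I x → ¬ I y → ¬ I ((x * y) * (x * y))
        ∉-sq x∉ y∉ = ∉-* (∉-* x∉ y∉) (∉-* x∉ y∉)
        resultantAt0 : ∀ k₀ k₁ k₂ g₀ g₁ g₂ a₀ a₁ a₂ b₀ b₁ b₂ →
          let p : Carrier → Carrier → Carrier
              p k g = k * (0ᶻ + g)
              a k g = p k g - c′ * 0ᶻ
              A = ⟨ a k₀ g₀ , a k₁ g₁ , a k₂ g₂ ⟩
              B = ⟨ p k₀ g₀ * b₀ , p k₁ g₁ * b₁ , p k₂ g₂ * b₂ ⟩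
              C = ⟨ p k₀ g₀ * a₀ , p k₁ g₁ * a₁ , p k₂ g₂ * a₂ ⟩
              E = ⟨ p k₀ g₀ * (a₀ * b₀) , p k₁ g₁ * (a₁ * b₁) , p k₂ g₂ * (a₂ * b₂) ⟩
          in resultant A B C E ≈
            (k₀ * g₀ * (k₀ * g₀) * (k₁ * g₁ * (k₁ * g₁) * (k₂ * g₂ * (k₂ * g₂)))) *
            ((a₁ - a₀) * ((a₀ - a₂) * (a₁ - a₂)) * ((b₀ - b₁) * ((b₀ - b₂) * (b₁ - b₂))))
        resultantAt0 k₀ k₁ k₂ g₀ g₁ g₂ a₀ a₁ a₂ b₀ b₁ b₂ = solve 13 (λ c′ k₀ k₁ k₂ g₀ g₁ g₂ a₀ a₁ a₂ b₀ b₁ b₂ →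
          let p = λ k g → k :* (con (+ 0) :+ g)
              a = λ k g → p k g :- c′ :* con (+ 0)
              A = ⟨ a k₀ g₀ , a k₁ g₁ , a k₂ g₂ ⟩
              B = ⟨ p k₀ g₀ :* b₀ , p k₁ g₁ :* b₁ , p k₂ g₂ :* b₂ ⟩
              C = ⟨ p k₀ g₀ :* a₀ , p k₁ g₁ :* a₁ , p k₂ g₂ :* a₂ ⟩
              E = ⟨ p k₀ g₀ :* (a₀ :* b₀) , p k₁ g₁ :* (a₁ :* b₁) , p k₂ g₂ :* (a₂ :* b₂) ⟩
          in Sym.resultant A B C E :=
            (k₀ :* g₀ :* (k₀ :* g₀) :* (k₁ :* g₁ :* (k₁ :* g₁) :* (k₂ :* g₂ :* (k₂ :* g₂)))) :*
            ((a₁ :- a₀) :* ((a₀ :- a₂) :* (a₁ :- a₂)) :* ((b₀ :- b₁) :* ((b₀ :- b₂) :* (b₁ :- b₂)))))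
          ≈-refl c′ k₀ k₁ k₂ g₀ g₁ g₂ a₀ a₁ a₂ b₀ b₁ b₂

-- The residue field 𝔽ₚ[t]/(f) and its norm graph

module CubicRing (a : ℤ) where
  open CubicOrder a

  ⊠-identityˡ : ∀ x → embed (+ 1) ⊠ x ≡ x
  ⊠-identityˡ x = trans (embed-⊠ (+ 1) x)
    (≡-triple (ℤₚ.*-identityˡ (Triple.c₀ x)) (ℤₚ.*-identityˡ (Triple.c₁ x)) (ℤₚ.*-identityˡ (Triple.c₂ x)))

  isCommutativeRing : IsCommutativeRing _≡_ _⊞_ _⊠_ ⊟_ (embed (+ 0)) (embed (+ 1))
  isCommutativeRing = record
    { isRing = record
      { +-isAbelianGroup = record
        { isGroup = record
          { isMonoid = record
            { isSemigroup = record
              { isMagma = record { isEquivalence = isEquivalence ; ∙-cong = cong₂ _⊞_ }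
              ; assoc = λ x y z → ≡-triple (ℤₚ.+-assoc (Triple.c₀ x) _ _) (ℤₚ.+-assoc (Triple.c₁ x) _ _) (ℤₚ.+-assoc (Triple.c₂ x) _ _) }
            ; identity = (λ x → ≡-triple (ℤₚ.+-identityˡ _) (ℤₚ.+-identityˡ _) (ℤₚ.+-identityˡ _))
                       , (λ x → ≡-triple (ℤₚ.+-identityʳ _) (ℤₚ.+-identityʳ _) (ℤₚ.+-identityʳ _)) }
          ; inverse = (λ x → ≡-triple (ℤₚ.+-inverseˡ (Triple.c₀ x)) (ℤₚ.+-inverseˡ (Triple.c₁ x)) (ℤₚ.+-inverseˡ (Triple.c₂ x)))
                    , (λ x → ≡-triple (ℤₚ.+-inverseʳ (Triple.c₀ x)) (ℤₚ.+-inverseʳ (Triple.c₁ x)) (ℤₚ.+-inverseʳ (Triple.c₂ x)))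
          ; ⁻¹-cong = cong ⊟_ }
        ; comm = λ x y → ≡-triple (ℤₚ.+-comm (Triple.c₀ x) _) (ℤₚ.+-comm (Triple.c₁ x) _) (ℤₚ.+-comm (Triple.c₂ x) _) }
      ; *-cong = cong₂ _⊠_
      ; *-assoc = ⊠-assoc
      ; *-identity = ⊠-identityˡ , λ x → trans (⊠-comm x _) (⊠-identityˡ x)
      ; distrib = (λ x y z → trans (⊠-comm x _) (trans (⊠-distribʳ-⊞ x y z) (cong₂ _⊞_ (⊠-comm y x) (⊠-comm z x))))
                , ⊠-distribʳ-⊞ }
    ; *-comm = ⊠-comm }

  commutativeRing : CommutativeRing 0ℓ 0ℓ
  commutativeRing = record { isCommutativeRing = isCommutativeRing }

  embed-homomorphism : CommutativeRing.rawRing ℤₚ.+-*-commutativeRing -Raw-AlmostCommutative⟶ fromCommutativeRing commutativeRing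
  embed-homomorphism = record
    { ⟦_⟧    = embed
    ; +-homo = λ m n → refl
    ; *-homo = λ m n → sym (trans (embed-⊠ m (embed n)) (≡-triple refl (ℤₚ.*-zeroʳ m) (ℤₚ.*-zeroʳ m)))
    ; -‿homo = λ m → refl
    ; 0-homo = refl
    ; 1-homo = refl }

module ModPrime (p : ℕ) (p-prime : Prime p) where
  open ℤ-Solver

  instance
    p-nonZero : ℕ.NonZero p
    p-nonZero = prime⇒nonZero p-prime

  infix 4 p∣_
  p∣_ : ℤ → Set
  p∣ x = + p ∣ℤ x

  p∣-prime : ∀ {x y} → p∣ x ℤ.* y → (p∣ x) ⊎ (p∣ y)
  p∣-prime {x} {y} d = Sum.map ∣ᵤ⇒∣ ∣ᵤ⇒∣ (euclidsLemma ℤ.∣ x ∣ ℤ.∣ y ∣ p-prime (subst (p ℕ∣.∣_) (ℤₚ.abs-* x y) (∣⇒∣ᵤ d)))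

  p∤1 : ¬ (p∣ + 1)
  p∤1 d = ¬prime[1] (subst Prime (ℕ∣.∣1⇒≡1 (∣⇒∣ᵤ d)) p-prime)

  p∣-% : ∀ x → p∣ x ℤ.- + (x %ℕ p)
  p∣-% x = dividesℤ (x /ℕ p) (begin
    x ℤ.- + (x %ℕ p)                                       ≡⟨ cong (ℤ._- + (x %ℕ p)) (a≡a%ℕn+[a/ℕn]*n x p) ⟩
    (+ (x %ℕ p) ℤ.+ (x /ℕ p) ℤ.* + p) ℤ.- + (x %ℕ p)    ≡⟨ solve 2 (λ r s → r :+ s :- r := s) refl (+ (x %ℕ p)) _ ⟩
    (x /ℕ p) ℤ.* + p                                     ∎)
    where open ≡-Reasoning

  p∣m-n⇒m≡n : ∀ {m n} → m ℕ.< p → n ℕ.< p → p∣ + m ℤ.- + n → m ≡ n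
  p∣m-n⇒m≡n {m} {n} m<p n<p d = ℤₚ.+-injective (ℤₚ.i-j≡0⇒i≡j (+ m) (+ n) (ℤₚ.∣i∣≡0⇒i≡0 (small _ bound (∣⇒∣ᵤ d))))
    where
    bound : ℤ.∣ + m ℤ.- + n ∣ ℕ.< p
    bound = ℕₚ.≤-<-trans (ℕₚ.≤-trans (ℕₚ.≤-reflexive (cong ℤ.∣_∣ (ℤₚ.m-n≡m⊖n m n))) (ℤₚ.∣m⊝n∣≤m⊔n m n)) (ℕₚ.⊔-pres-<m m<p n<p)
    small : ∀ k → k ℕ.< p → p ℕ∣.∣ k → k ≡ 0
    small zero    _   _   = refl
    small (suc k) k<p p∣k = contradiction k<p (ℕₚ.≤⇒≯ (ℕ∣.∣⇒≤ p∣k))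

  toℕ-injective-mod : ∀ (i j : Fin p) → p∣ + toℕ i ℤ.- + toℕ j → i ≡ j
  toℕ-injective-mod i j d = toℕ-injective (p∣m-n⇒m≡n (toℕ<n i) (toℕ<n j) d)

  inverse : ∀ x → ¬ (p∣ x) → ∃[ y ] (p∣ x ℤ.* y ℤ.- + 1)
  inverse x p∤x = lift (inverseℕ (x %ℕ p) (n%ℕd<d x p) λ r≡0 → p∤x (subst p∣_ (trans (cong (λ r → x ℤ.- + r) r≡0) (ℤₚ.+-identityʳ x)) (p∣-% x)))
    where
    inverseℕ : ∀ r → r ℕ.< p → ¬ r ≡ 0 → ∃[ y ] (p∣ + r ℤ.* y ℤ.- + 1)
    inverseℕ r r<p r≢0 with coprime-Bézout (prime⇒coprime p-prime {{ℕ.≢-nonZero r≢0}} r<p)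
    ... | Bézout.+- u v eq = ℤ.- + v , dividesℤ (ℤ.- + u) (begin
      + r ℤ.* ℤ.- + v ℤ.- + 1       ≡⟨ solve 2 (λ r v → r :* :- v :- con (+ 1) := :- (con (+ 1) :+ v :* r)) refl (+ r) (+ v) ⟩
      ℤ.- (+ 1 ℤ.+ + v ℤ.* + r)     ≡⟨ cong (λ t → ℤ.- (+ 1 ℤ.+ t)) (ℤₚ.pos-* v r) ⟨
      ℤ.- + (1 ℕ.+ v ℕ.* r)         ≡⟨ cong (ℤ.-_ ∘ +_) eq ⟩
      ℤ.- + (u ℕ.* p)               ≡⟨ cong ℤ.-_ (ℤₚ.pos-* u p) ⟩
      ℤ.- (+ u ℤ.* + p)             ≡⟨ ℤₚ.neg-distribˡ-* (+ u) (+ p) ⟩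
      ℤ.- + u ℤ.* + p               ∎)
      where open ≡-Reasoning
    ... | Bézout.-+ u v eq = + v , dividesℤ (+ u) (begin
      + r ℤ.* + v ℤ.- + 1             ≡⟨ cong (ℤ._- + 1) (trans (ℤₚ.*-comm (+ r) (+ v)) (sym (ℤₚ.pos-* v r))) ⟩
      + (v ℕ.* r) ℤ.- + 1             ≡⟨ cong (λ t → + t ℤ.- + 1) eq ⟨
      + 1 ℤ.+ + (u ℕ.* p) ℤ.- + 1     ≡⟨ solve 1 (λ t → con (+ 1) :+ t :- con (+ 1) := t) refl (+ (u ℕ.* p)) ⟩
      + (u ℕ.* p)                     ≡⟨ ℤₚ.pos-* u p ⟩
      + u ℤ.* + p                     ∎)
      where open ≡-Reasoning
    lift : ∃[ y ] (p∣ + (x %ℕ p) ℤ.* y ℤ.- + 1) → ∃[ y ] (p∣ x ℤ.* y ℤ.- + 1)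
    lift (y , d) = y , subst p∣_
      (solve 3 (λ x r y → y :* (x :- r) :+ (r :* y :- con (+ 1)) := x :* y :- con (+ 1)) refl x (+ (x %ℕ p)) y)
      (∣m∣n⇒∣m+n (∣n⇒∣m*n y (p∣-% x)) d)

  open CubicOrder using (cubic)

  -- f(0) = -1, and likewise f(-1) = 1 for `p∤τ+1`. So the coefficient -τ(τ+1) of a in f(τ) is
  -- invertible at every root τ.
  p∤τ : ∀ a τ → p∣ cubic a τ → ¬ (p∣ τ)
  p∤τ a τ root d = p∤1 (subst p∣_
    (solve 2 (λ a τ → (τ :* τ :- (a :* τ :+ (a :+ con (+ 3)))) :* τ :-
       (τ :* (τ :* τ) :- (a :* (τ :* τ) :+ ((a :+ con (+ 3)) :* τ :+ con (+ 1)))) := con (+ 1)) refl a τ)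
    (∣m∣n⇒∣m-n (∣n⇒∣m*n (τ ℤ.* τ ℤ.- (a ℤ.* τ ℤ.+ (a ℤ.+ + 3))) d) root))

  p∤τ+1 : ∀ a τ → p∣ cubic a τ → ¬ (p∣ τ ℤ.+ + 1)
  p∤τ+1 a τ root d = p∤1 (subst p∣_
    (solve 2 (λ a τ → (τ :* (τ :* τ) :- (a :* (τ :* τ) :+ ((a :+ con (+ 3)) :* τ :+ con (+ 1))))
       :- (τ :* τ :- ((a :+ con (+ 1)) :* τ :+ con (+ 2))) :* (τ :+ con (+ 1)) := con (+ 1)) refl a τ)
    (∣m∣n⇒∣m-n root (∣n⇒∣m*n (τ ℤ.* τ ℤ.- ((a ℤ.+ + 1) ℤ.* τ ℤ.+ + 2)) d)))

  -- A root τ of cubic a determines a, since a τ(τ+1) = τ³-3τ-1; as τ ≠ 0, fewer than p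
  -- values of a are possible.
  ∃-rootless : ∃[ a ] ∀ τ → ¬ (p∣ cubic a τ)
  ∃-rootless = extend (¬∀⟶∃¬ p _ (λ a → any? λ τ → + p ∣ℤ? cubic (+ toℕ a) (+ toℕ τ)) (¬all-roots p refl))
    where
    HasRoot : Fin p → Set
    HasRoot a = ∃[ τ ] (p∣ cubic (+ toℕ a) (+ toℕ {p} τ))

    extend : ∃[ a ] ¬ HasRoot a → ∃[ a ] ∀ τ → ¬ (p∣ cubic a τ)
    extend (a , rootless) = + toℕ a , λ τ root → rootless (fromℕ< (n%ℕd<d τ p) ,
      subst (λ r → p∣ cubic (+ toℕ a) (+ r)) (sym (toℕ-fromℕ< (n%ℕd<d τ p))) (subst p∣_
        (solve 3 (λ a τ r → (τ :* (τ :* τ) :- (a :* (τ :* τ) :+ ((a :+ con (+ 3)) :* τ :+ con (+ 1)))) :-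
            (τ :* τ :+ τ :* r :+ r :* r :- (a :* (τ :+ r) :+ (a :+ con (+ 3)))) :* (τ :- r) :=
            r :* (r :* r) :- (a :* (r :* r) :+ ((a :+ con (+ 3)) :* r :+ con (+ 1))))
          refl (+ toℕ a) τ (+ (τ %ℕ p)))
        (∣m∣n⇒∣m-n root (∣n⇒∣m*n
          (τ ℤ.* τ ℤ.+ τ ℤ.* + (τ %ℕ p) ℤ.+ + (τ %ℕ p) ℤ.* + (τ %ℕ p)
            ℤ.- (+ toℕ a ℤ.* (τ ℤ.+ + (τ %ℕ p)) ℤ.+ (+ toℕ a ℤ.+ + 3)))
          (p∣-% τ)))))

    ¬all-roots : ∀ q → p ≡ q → ¬ (∀ a → HasRoot a)
    ¬all-roots zero    p≡0  _    = contradiction p≡0 (ℕ.≢-nonZero⁻¹ p)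
    ¬all-roots (suc q) refl root = ℕₚ.1+n≰n (injective⇒≤ {f = λ a → punchOut (0≢root a)}
      λ {a} {b} eq → root-injective a b (punchOut-injective (0≢root a) (0≢root b) eq))
      where
      0≢root : ∀ a → zero ≢ proj₁ (root a)
      0≢root a eq = p∤τ (+ toℕ a) _ (proj₂ (root a)) (subst (λ τ → p∣ + toℕ τ) eq (dividesℤ (+ 0) refl))

      root-injective : ∀ a b → proj₁ (root a) ≡ proj₁ (root b) → a ≡ b
      root-injective a b eq = conclude (p∣-prime {+ toℕ b ℤ.- + toℕ a} {t ℤ.* (t ℤ.+ + 1)} (subst p∣_
        (solve 3 (λ a b τ → (τ :* (τ :* τ) :- (a :* (τ :* τ) :+ ((a :+ con (+ 3)) :* τ :+ con (+ 1)))) :-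
            (τ :* (τ :* τ) :- (b :* (τ :* τ) :+ ((b :+ con (+ 3)) :* τ :+ con (+ 1)))) :=
            (b :- a) :* (τ :* (τ :+ con (+ 1)))) refl (+ toℕ a) (+ toℕ b) t)
        (∣m∣n⇒∣m-n (proj₂ (root a)) b-root)))
        where
        t = + toℕ (proj₁ (root a))
        b-root : p∣ cubic (+ toℕ b) t
        b-root = subst (λ τ → p∣ cubic (+ toℕ b) (+ toℕ τ)) (sym eq) (proj₂ (root b))
        conclude : (p∣ + toℕ b ℤ.- + toℕ a) ⊎ (p∣ t ℤ.* (t ℤ.+ + 1)) → a ≡ b
        conclude (inj₁ d) = sym (toℕ-injective-mod b a d)
        conclude (inj₂ d) with p∣-prime {t} d
        ... | inj₁ d₀ = contradiction d₀ (p∤τ (+ toℕ b) t b-root)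
        ... | inj₂ d₁ = contradiction d₁ (p∤τ+1 (+ toℕ b) t b-root)

module CubicResidueField (p : ℕ) (p-prime : Prime p) (a : ℤ)
  (rootless : ∀ τ → ¬ (+ p ∣ℤ CubicOrder.cubic a τ)) where
  open ℤ-Solver
  open ModPrime p p-prime
  open CubicOrder a
  open CubicRing a
  open PolynomialFunctions commutativeRing embed-homomorphism
    using (*-interchange₃; [z+x]-[z+y]≈x-y; [x+z]-[y+z]≈x-y; [y+z]+[x-y]≈x+z; [x-z]-[y-z]≈x-y;
           module Ideal; module PrimeIdeal)

  infixl 6 _⊖_
  _⊖_ : Order → Order → Order
  x ⊖ y = x ⊞ (⊟ y)

  -- The ideal generated by p. Congruence modulo I replaces the residue field as a type; that the
  -- quotient is a domain is `I-prime`.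
  I : Order → Set
  I x = ∃[ y ] x ≡ embed (+ p) ⊠ y

  I-+ : ∀ {x y} → I x → I y → I (x ⊞ y)
  I-+ (x′ , refl) (y′ , refl) = x′ ⊞ y′ , sym (CommutativeRing.distribˡ commutativeRing (embed (+ p)) x′ y′)

  I-* : ∀ x {y} → I y → I (x ⊠ y)
  I-* x (y′ , refl) = x ⊠ y′ , (begin
    x ⊠ (embed (+ p) ⊠ y′)  ≡⟨ ⊠-assoc x (embed (+ p)) y′ ⟨
    (x ⊠ embed (+ p)) ⊠ y′  ≡⟨ cong (_⊠ y′) (⊠-comm x (embed (+ p))) ⟩
    (embed (+ p) ⊠ x) ⊠ y′  ≡⟨ ⊠-assoc (embed (+ p)) x y′ ⟩
    embed (+ p) ⊠ (x ⊠ y′)  ∎)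
    where open ≡-Reasoning

  open Ideal I (subst I) I-+ I-* using (I-neg; I-−; I-*ʳ; I-*-cong)

  I-σ : ∀ {x} → I x → I (σ x)
  I-σ (y , refl) = σ y , trans (σ-⊠ (embed (+ p)) y) (cong (_⊠ σ y) (σ-embed (+ p)))

  ∣⇒I : ∀ {x₀ x₁ x₂} → p∣ x₀ → p∣ x₁ → p∣ x₂ → I ⟨ x₀ , x₁ , x₂ ⟩
  ∣⇒I (dividesℤ q₀ refl) (dividesℤ q₁ refl) (dividesℤ q₂ refl) = ⟨ q₀ , q₁ , q₂ ⟩ ,
    sym (trans (embed-⊠ (+ p) ⟨ q₀ , q₁ , q₂ ⟩) (≡-triple (ℤₚ.*-comm (+ p) q₀) (ℤₚ.*-comm (+ p) q₁) (ℤₚ.*-comm (+ p) q₂)))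

  I⇒∣₀ : ∀ {x} → I x → p∣ Triple.c₀ x
  I⇒∣₀ (y , refl) = dividesℤ (Triple.c₀ y) (trans (cong Triple.c₀ (embed-⊠ (+ p) y)) (ℤₚ.*-comm (+ p) _))

  I⇒∣₁ : ∀ {x} → I x → p∣ Triple.c₁ x
  I⇒∣₁ (y , refl) = dividesℤ (Triple.c₁ y) (trans (cong Triple.c₁ (embed-⊠ (+ p) y)) (ℤₚ.*-comm (+ p) _))

  I⇒∣₂ : ∀ {x} → I x → p∣ Triple.c₂ x
  I⇒∣₂ (y , refl) = dividesℤ (Triple.c₂ y) (trans (cong Triple.c₂ (embed-⊠ (+ p) y)) (ℤₚ.*-comm (+ p) _))

  embed-*  : ∀ m n → embed (m ℤ.* n) ≡ embed m ⊠ embed n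
  embed-* = _-Raw-AlmostCommutative⟶_.*-homo embed-homomorphism

  norm-⊠ : ∀ x y → norm (x ⊠ y) ≡ norm x ℤ.* norm y
  norm-⊠ x y = cong Triple.c₀ (begin
    embed (norm (x ⊠ y))                            ≡⟨ embed-norm (x ⊠ y) ⟩
    x ⊠ y ⊠ (σ (x ⊠ y) ⊠ σ (σ (x ⊠ y)))            ≡⟨ cong₂ (λ u v → x ⊠ y ⊠ (u ⊠ v)) (σ-⊠ x y) (trans (cong σ (σ-⊠ x y)) (σ-⊠ (σ x) (σ y))) ⟩
    x ⊠ y ⊠ (σ x ⊠ σ y ⊠ (σ (σ x) ⊠ σ (σ y)))      ≡⟨ *-interchange₃ x y (σ x) (σ y) (σ (σ x)) (σ (σ y)) ⟩
    x ⊠ (σ x ⊠ σ (σ x)) ⊠ (y ⊠ (σ y ⊠ σ (σ y)))    ≡⟨ cong₂ _⊠_ (embed-norm x) (embed-norm y) ⟨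
    embed (norm x) ⊠ embed (norm y)                 ≡⟨ embed-* (norm x) (norm y) ⟨
    embed (norm x ℤ.* norm y)                       ∎)
    where open ≡-Reasoning

  I-norm : ∀ {x} → I x → p∣ norm x
  I-norm {x} x∈ = I⇒∣₀ (subst I (sym (embed-norm x)) (I-*ʳ (σ x ⊠ σ (σ x)) x∈))

  σ-⊖ : ∀ x y → σ (x ⊖ y) ≡ σ x ⊖ σ y
  σ-⊖ x y = trans (σ-⊞ x (⊟ y)) (cong (σ x ⊞_) (σ-⊟ y))

  norm-cong : ∀ x y → I (x ⊖ y) → p∣ norm x ℤ.- norm y
  norm-cong x y d = I⇒∣₀ (subst I (cong₂ _⊖_ (sym (embed-norm x)) (sym (embed-norm y)))
    (I-*-cong d (I-*-cong d′ (subst I (σ-⊖ (σ x) (σ y)) (I-σ d′)))))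
    where
    d′ : I (σ x ⊖ σ y)
    d′ = subst I (σ-⊖ x y) (I-σ d)

  -- With y inverse to x₁, y³ N(x₀ + x₁t) = N(x₀y + x₁y t) ≡ N(x₀y + t) = -f(-x₀y). The cofactor of
  -- x₁y - 1 in the difference of the two norms is `Q`.
  norm-linear-root : ∀ x₀ x₁ y → p∣ x₁ ℤ.* y ℤ.- + 1 → p∣ norm ⟨ x₀ , x₁ , + 0 ⟩ → p∣ cubic (ℤ.- (x₀ ℤ.* y))
  norm-linear-root x₀ x₁ y e d = subst p∣_ identity (∣m∣n⇒∣m-n {m = E ℤ.* Q} {n = Y ℤ.* norm ⟨ x₀ , x₁ , + 0 ⟩}
      (∣m⇒∣m*n {m = E} Q e) (∣n⇒∣m*n Y {n = norm ⟨ x₀ , x₁ , + 0 ⟩} d))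
    where
    E Q Y N : ℤ
    E = x₁ ℤ.* y ℤ.- + 1
    Q = a ℤ.* (x₀ ℤ.* y ℤ.* (x₀ ℤ.* y)) ℤ.- (a ℤ.+ + 3) ℤ.* (x₀ ℤ.* y) ℤ.* (x₁ ℤ.* y ℤ.+ + 1) ℤ.+
          (x₁ ℤ.* y ℤ.* (x₁ ℤ.* y) ℤ.+ x₁ ℤ.* y ℤ.+ + 1)
    Y = y ℤ.* (y ℤ.* y)
    N = x₀ ℤ.* (x₀ ℤ.* x₀) ℤ.+ x₁ ℤ.* (a ℤ.* (x₀ ℤ.* x₀) ℤ.+ x₁ ℤ.* (x₁ ℤ.- (a ℤ.+ + 3) ℤ.* x₀))
    expanded : E ℤ.* Q ℤ.- Y ℤ.* N ≡ cubic (ℤ.- (x₀ ℤ.* y))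
    expanded = solve 4 (λ a x₀ x₁ y →
        let E = x₁ :* y :- con (+ 1)
            Q = a :* (x₀ :* y :* (x₀ :* y)) :- (a :+ con (+ 3)) :* (x₀ :* y) :* (x₁ :* y :+ con (+ 1)) :+
                (x₁ :* y :* (x₁ :* y) :+ x₁ :* y :+ con (+ 1))
            τ = :- (x₀ :* y)
        in E :* Q :- y :* (y :* y) :* (x₀ :* (x₀ :* x₀) :+ x₁ :* (a :* (x₀ :* x₀) :+ x₁ :* (x₁ :- (a :+ con (+ 3)) :* x₀))) :=
           τ :* (τ :* τ) :- (a :* (τ :* τ) :+ ((a :+ con (+ 3)) :* τ :+ con (+ 1))))
      refl a x₀ x₁ y
    identity : E ℤ.* Q ℤ.- Y ℤ.* norm ⟨ x₀ , x₁ , + 0 ⟩ ≡ cubic (ℤ.- (x₀ ℤ.* y))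
    identity = trans (cong (λ N → E ℤ.* Q ℤ.- Y ℤ.* N) (norm-linear x₀ x₁)) expanded

  norm-linear-anisotropic : ∀ x₀ x₁ → p∣ norm ⟨ x₀ , x₁ , + 0 ⟩ → (p∣ x₀) × (p∣ x₁)
  norm-linear-anisotropic x₀ x₁ d = cases (+ p ∣ℤ? x₁)
    where
    K : ℤ
    K = a ℤ.* (x₀ ℤ.* x₀) ℤ.+ x₁ ℤ.* (x₁ ℤ.- (a ℤ.+ + 3) ℤ.* x₀)
    cube : norm ⟨ x₀ , x₁ , + 0 ⟩ ℤ.- x₁ ℤ.* K ≡ x₀ ℤ.* (x₀ ℤ.* x₀)
    cube = trans (cong (ℤ._- x₁ ℤ.* K) (norm-linear x₀ x₁))
      (solve 2 (λ s t → s :+ t :- t := s) refl (x₀ ℤ.* (x₀ ℤ.* x₀)) (x₁ ℤ.* K))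
    cases : Dec (p∣ x₁) → (p∣ x₀) × (p∣ x₁)
    cases (yes d₁) = [ id , [ id , id ]′ ∘ p∣-prime {x₀} {x₀} ]′ (p∣-prime {x₀} {x₀ ℤ.* x₀}
      (subst p∣_ cube (∣m∣n⇒∣m-n {m = norm ⟨ x₀ , x₁ , + 0 ⟩} {n = x₁ ℤ.* K} d (∣m⇒∣m*n {m = x₁} K d₁)))) , d₁
    cases (no p∤x₁) = let y , e = inverse x₁ p∤x₁
                      in contradiction (norm-linear-root x₀ x₁ y e d) (rootless (ℤ.- (x₀ ℤ.* y)))

  -- If x₂ ≢ 0, a linear factor M removes the quadratic term of x, and M is invertible.
  norm-anisotropic : ∀ x → p∣ norm x → I x
  norm-anisotropic x@(⟨ x₀ , x₁ , x₂ ⟩) d = cases (+ p ∣ℤ? x₂)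
    where
    p∣norm-linear : p∣ x₂ → p∣ norm ⟨ x₀ , x₁ , + 0 ⟩
    p∣norm-linear d₂ = subst p∣_ (solve 2 (λ m n → m :- (m :- n) := n) refl (norm x) (norm ⟨ x₀ , x₁ , + 0 ⟩))
      (∣m∣n⇒∣m-n {m = norm x} {n = norm x ℤ.- norm ⟨ x₀ , x₁ , + 0 ⟩} d (norm-cong x ⟨ x₀ , x₁ , + 0 ⟩ (∣⇒I
        (dividesℤ (+ 0) (ℤₚ.+-inverseʳ x₀)) (dividesℤ (+ 0) (ℤₚ.+-inverseʳ x₁)) (subst p∣_ (sym (ℤₚ.+-identityʳ x₂)) d₂))))
    M L : Order
    M = ⟨ ℤ.- (a ℤ.* x₂ ℤ.+ x₁) , x₂ , + 0 ⟩
    L = x ⊠ M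
    L-linear : L ≡ ⟨ Triple.c₀ L , Triple.c₁ L , + 0 ⟩
    L-linear = ≡-triple refl refl (⊠-linear x₀ x₁ x₂)
    L∈ : I L
    L∈ = let d₀ , d₁ = norm-linear-anisotropic (Triple.c₀ L) (Triple.c₁ L)
                         (subst (p∣_ ∘ norm) L-linear (subst p∣_ (sym (norm-⊠ x M)) (∣m⇒∣m*n {m = norm x} (norm M) d)))
         in subst I (sym L-linear) (∣⇒I d₀ d₁ (dividesℤ (+ 0) refl))
    normM-x∈ : I (embed (norm M) ⊠ x)
    normM-x∈ = subst I (trans (⊠-assoc x M _) (trans (cong (x ⊠_) (sym (embed-norm M))) (⊠-comm x _))) (I-*ʳ (σ M ⊠ σ (σ M)) L∈)
    p∣normM-x₂ : p∣ norm M ℤ.* x₂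
    p∣normM-x₂ = subst p∣_ (cong Triple.c₂ (embed-⊠ (norm M) x)) (I⇒∣₂ normM-x∈)
    cases : Dec (p∣ x₂) → I x
    cases (yes d₂) = let d₀ , d₁ = norm-linear-anisotropic x₀ x₁ (p∣norm-linear d₂) in ∣⇒I d₀ d₁ d₂
    -- p divides N(M)x₂. Should it divide N(M), then the linear case for M, whose leading
    -- coefficient is x₂, gives p ∣ x₂ all the same.
    cases (no p∤x₂) = contradiction
      ([ proj₂ ∘ norm-linear-anisotropic (ℤ.- (a ℤ.* x₂ ℤ.+ x₁)) x₂ , id ]′ (p∣-prime {norm M} {x₂} p∣normM-x₂)) p∤x₂

  I-prime : ∀ {x y} → I (x ⊠ y) → I x ⊎ I y
  I-prime {x} {y} d = Sum.map (norm-anisotropic x) (norm-anisotropic y)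
    (p∣-prime {norm x} {norm y} (subst p∣_ (norm-⊠ x y) (I-norm d)))

  I-σ⁻¹ : ∀ {x} → I (σ x) → I x
  I-σ⁻¹ {x} d = norm-anisotropic x (I⇒∣₀ (subst I (sym (embed-norm x)) (I-* x (I-*ʳ (σ (σ x)) d))))

  open PrimeIdeal I (subst I) I-+ I-* I-prime using (¬seven-solutions)

  module _ (A : Fin 4 → Order) (c : Fin 4 → ℤ) (X : Fin 7 → Order) (x : Fin 7 → ℤ)
    (c-nonzero : ∀ i → ¬ (p∣ c i))
    (vertices-distinct : ∀ {i j} → i ≢ j → I (A i ⊖ A j) → ¬ (p∣ c i ℤ.- c j))
    (neighbours-distinct : ∀ {k l} → k ≢ l → I (X k ⊖ X l) → ¬ (p∣ x k ℤ.- x l))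
    (adjacent : ∀ i k → p∣ c i ℤ.* norm (A i ⊞ X k) ℤ.- x k) where
    private
      N : Fin 4 → Fin 7 → ℤ
      N i k = norm (A i ⊞ X k)

      X-distinct : ∀ {k l} → k ≢ l → ¬ I (X k ⊖ X l)
      X-distinct {k} {l} k≢l d = neighbours-distinct k≢l d (subst p∣_
        (solve 5 (λ c m n x y → c :* (m :- n) :- (c :* m :- x) :+ (c :* n :- y) := x :- y) refl (c 0F) (N 0F k) (N 0F l) (x k) (x l))
        (∣m∣n⇒∣m+n {m = c 0F ℤ.* (N 0F k ℤ.- N 0F l) ℤ.- (c 0F ℤ.* N 0F k ℤ.- x k)} {n = c 0F ℤ.* N 0F l ℤ.- x l}
          (∣m∣n⇒∣m-n {m = c 0F ℤ.* (N 0F k ℤ.- N 0F l)} {n = c 0F ℤ.* N 0F k ℤ.- x k}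
            (∣n⇒∣m*n (c 0F) (norm-cong _ _ (subst I (sym ([z+x]-[z+y]≈x-y (X k) (X l) (A 0F))) d)))
            (adjacent 0F k))
          (adjacent 0F l)))

      -- If Aᵢ ≡ Aⱼ, then (cᵢ - cⱼ) N(Aᵢ + X) ≡ 0 with cᵢ ≢ cⱼ, so every common neighbour has X ≡
      -- -Aᵢ; but two neighbours already differ in X.
      A-distinct : ∀ {i j} → i ≢ j → ¬ I (A i ⊖ A j)
      A-distinct {i} {j} i≢j d = X-distinct {0F} {1F} (λ ())
        (subst I ([z+x]-[z+y]≈x-y (X 0F) (X 1F) (A i)) (I-− (vanish 0F) (vanish 1F)))
        where
        scaled-difference : ∀ k → p∣ (c i ℤ.- c j) ℤ.* N i k
        scaled-difference k = subst p∣_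
          (solve 5 (λ b c m n x → (b :* m :- x) :- (c :* n :- x) :- c :* (m :- n) := (b :- c) :* m) refl (c i) (c j) (N i k) (N j k) (x k))
          (∣m∣n⇒∣m-n {m = (c i ℤ.* N i k ℤ.- x k) ℤ.- (c j ℤ.* N j k ℤ.- x k)} {n = c j ℤ.* (N i k ℤ.- N j k)}
            (∣m∣n⇒∣m-n {m = c i ℤ.* N i k ℤ.- x k} {n = c j ℤ.* N j k ℤ.- x k} (adjacent i k) (adjacent j k))
            (∣n⇒∣m*n (c j) (norm-cong _ _ (subst I (sym ([x+z]-[y+z]≈x-y (A i) (A j) (X k))) d))))
        vanish : ∀ k → I (A i ⊞ X k)
        vanish k = [ (λ e → contradiction e (vertices-distinct i≢j d)) , norm-anisotropic (A i ⊞ X k) ]′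
          (p∣-prime {c i ℤ.- c j} {N i k} (scaled-difference k))

      D : Fin 3 → Order
      D i = A (inject₁ i) ⊖ A 3F

      s : Fin 7 → Order
      s k = A 3F ⊞ X k

      inject₁≢3 : ∀ (i : Fin 3) → inject₁ i ≢ 3F
      inject₁≢3 0F ()
      inject₁≢3 1F ()
      inject₁≢3 2F ()

      embed-c-norm : ∀ m y → embed (m ℤ.* norm y) ≡ embed m ⊠ (y ⊠ (σ y ⊠ σ (σ y)))
      embed-c-norm m y = trans (embed-* m (norm y)) (cong (embed m ⊠_) (embed-norm y))

      shift : ∀ i k → s k ⊞ D i ≡ A (inject₁ i) ⊞ X k
      shift i k = [y+z]+[x-y]≈x+z (A (inject₁ i)) (A 3F) (X k)

      equation : ∀ k i → I (embed (c (inject₁ i)) ⊠ ((s k ⊞ D i) ⊠ ((σ (s k) ⊞ σ (D i)) ⊠ (σ (σ (s k)) ⊞ σ (σ (D i)))))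
                              ⊖ embed (c 3F) ⊠ (s k ⊠ (σ (s k) ⊠ σ (σ (s k)))))
      equation k i = subst I (cong₂ _⊖_ lhs (embed-c-norm (c 3F) (s k))) (∣⇒I difference (dividesℤ (+ 0) refl) (dividesℤ (+ 0) refl))
        where
        y = s k ⊞ D i
        lhs : embed (c (inject₁ i) ℤ.* N (inject₁ i) k) ≡
              embed (c (inject₁ i)) ⊠ (y ⊠ ((σ (s k) ⊞ σ (D i)) ⊠ (σ (σ (s k)) ⊞ σ (σ (D i)))))
        lhs = trans (cong (λ z → embed (c (inject₁ i) ℤ.* norm z)) (sym (shift i k)))
          (trans (embed-c-norm (c (inject₁ i)) y) (cong₂ (λ u v → embed (c (inject₁ i)) ⊠ (y ⊠ (u ⊠ v)))
            (σ-⊞ (s k) (D i)) (trans (cong σ (σ-⊞ (s k) (D i))) (σ-⊞ (σ (s k)) (σ (D i))))))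
        difference : p∣ c (inject₁ i) ℤ.* N (inject₁ i) k ℤ.- c 3F ℤ.* N 3F k
        difference = subst p∣_ (solve 3 (λ m n x → (m :- x) :- (n :- x) := m :- n) refl (c (inject₁ i) ℤ.* N (inject₁ i) k) (c 3F ℤ.* N 3F k) (x k))
          (∣m∣n⇒∣m-n {m = c (inject₁ i) ℤ.* N (inject₁ i) k ℤ.- x k} {n = c 3F ℤ.* N 3F k ℤ.- x k} (adjacent (inject₁ i) k) (adjacent 3F k))

      D-distinct : ∀ {i j} → i ≢ j → ¬ I (D i ⊖ D j)
      D-distinct {i} {j} i≢j d = A-distinct (i≢j ∘ inject₁-injective)
        (subst I ([x-z]-[y-z]≈x-y (A (inject₁ i)) (A (inject₁ j)) (A 3F)) d)

      σD-distinct : ∀ {i j} → i ≢ j → ¬ I (σ (D i) ⊖ σ (D j))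
      σD-distinct {i} {j} i≢j d = D-distinct i≢j (I-σ⁻¹ (subst I (sym (σ-⊖ (D i) (D j))) d))

    -- Comparison with the fourth vertex eliminates the labels: cᵢ N(s + Dᵢ) ≡ c₃ N(s) for s = A₃ +
    -- X and Dᵢ = Aᵢ - A₃. Each norm is a product over the conjugates, so (s, σs, σ²s) solves a
    -- system of three equations that are linear in each variable, with shifts Dᵢ, σDᵢ, σ²Dᵢ.
    norm-graph-K₄₇-free : ⊥
    norm-graph-K₄₇-free = ¬seven-solutions (λ i → embed (c (inject₁ i))) (σ ∘ D) (σ ∘ σ ∘ D) D (embed (c 3F)) s (σ ∘ s) (σ ∘ σ ∘ s)
      (λ i d → c-nonzero (inject₁ i) (I⇒∣₀ d))
      (λ i → A-distinct (inject₁≢3 i))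
      σD-distinct
      (λ {i} {j} i≢j d → σD-distinct i≢j (I-σ⁻¹ (subst I (sym (σ-⊖ (σ (D i)) (σ (D j)))) d)))
      (λ {k} {l} k≢l d → X-distinct k≢l (subst I ([z+x]-[z+y]≈x-y (X k) (X l) (A 3F)) d))
      equation

open import Data.Nat.Base hiding (_/_)
open import Data.Nat.Properties hiding (_≟_; suc-injective)
open import Algebra.Properties.Semiring.Sum +-*-semiring
  using (sum; sum-syntax; sum-cong-≗; ∑-comm; ∑-distrib-+; *-distribˡ-sum; *-distribʳ-sum)

-- Primes near n^(1/4)

-- Stands in for floors of roots, logarithms and quotients: the two halves of the conclusion are the
-- bounds from below and above.
threshold : ∀ {P : ℕ → Set} → Decidable P → P 0 → ∀ b → ¬ P b → ∃[ e ] (P e × ¬ P (suc e))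
threshold P? P0 zero    ¬P = contradiction P0 ¬P
threshold P? P0 (suc b) ¬P with P? b
... | yes Pb = b , Pb , ¬P
... | no ¬Pb = threshold P? P0 b ¬Pb

^-distribʳ-* : ∀ k m n → (m * n) ^ k ≡ m ^ k * n ^ k
^-distribʳ-* zero    m n = refl
^-distribʳ-* (suc k) m n = trans (cong (m * n *_) (^-distribʳ-* k m n))
  (solve 4 (λ m n s t → m :* n :* (s :* t) := m :* s :* (n :* t)) refl m n (m ^ k) (n ^ k))
  where open ℕ-Solver

n<2^n : ∀ n → n < 2 ^ n
n<2^n zero    = s≤s z≤n
n<2^n (suc n) = begin-strict
  suc n              ≤⟨ n<2^n n ⟩
  2 ^ n              <⟨ m<m+n (2 ^ n) (m^n>0 2 n) ⟩
  2 ^ n + 2 ^ n      ≡⟨ cong (_+_ (2 ^ n)) (+-identityʳ (2 ^ n)) ⟨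
  2 ^ suc n          ∎
  where open ≤-Reasoning

n<m^n : ∀ {m} → 2 ≤ m → ∀ n → n < m ^ n
n<m^n 2≤m n = <-≤-trans (n<2^n n) (^-monoˡ-≤ n 2≤m)

-- The integer D·∫₀¹ xⁱ(1-x)ʲ dx is D i! j! / (i+j+1)!.
module _ (D M : ℕ) (D>0 : 0 < D) (D-multiple : ∀ j → 0 < j → j ≤ M → j ∣ D) where

  -- From x + (1-x) = 1, the integral of xⁱ⁺¹(1-x)ʲ is that of xⁱ(1-x)ʲ minus that of xⁱ(1-x)ʲ⁺¹.
  -- This descends to i = 0, where the value is D/(j+1).
  beta-integral : ∀ i j → i + j < M → (suc (i + j)) ! ∣ D * (i ! * j !)
  beta-integral zero    j j<M  = *-pres-∣ (D-multiple (suc j) z<s j<M) (n∣m*n 1)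
  beta-integral (suc i) j ij<M = ∣m+n∣m⇒∣n
    (subst ((suc (suc (i + j))) ! ∣_)
      (solve 5 (λ i j D s t → (con 2 :+ (i :+ j)) :* (D :* (s :* t)) :=
          D :* (s :* ((con 1 :+ j) :* t)) :+ D :* ((con 1 :+ i) :* s :* t)) refl i j D (i !) (j !))
      (*-monoʳ-∣ (suc (suc (i + j))) (beta-integral i j (≤-trans (n≤1+n _) ij<M))))
    (subst (λ k → (suc k) ! ∣ D * (i ! * (suc j) !)) (+-suc i j)
      (beta-integral i (suc j) (subst (_< M) (sym (+-suc i j)) ij<M)))
    where open ℕ-Solver

  -- Expanding 1 = (x + (1-x))ʳ writes the integral as a sum of 2ʳ integrals of the same kind; times
  -- D, each is a positive integer.
  beta-bound : ∀ r i j → r + (i + j) < M → 2 ^ r * (suc (i + j)) ! ≤ D * (i ! * j !)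
  beta-bound zero i j ij<M = ≤-trans (≤-reflexive (+-identityʳ _))
    (∣⇒≤ {{>-nonZero (*-mono-≤ D>0 (*-mono-≤ (1≤n! i) (1≤n! j)))}} (beta-integral i j ij<M))
  beta-bound (suc r) i j rij<M = *-cancelˡ-≤ (2 + (i + j)) (begin
    (2 + (i + j)) * (2 ^ suc r * (suc (i + j)) !)
      ≡⟨ solve 3 (λ t s f → t :* ((s :+ (s :+ con 0)) :* f) := s :* (t :* f) :+ s :* (t :* f)) refl (2 + (i + j)) (2 ^ r) ((suc (i + j)) !) ⟩
    2 ^ r * (suc (suc i + j)) ! + 2 ^ r * (suc (suc i + j)) !
      ≡⟨ cong (λ k → 2 ^ r * (suc (suc i + j)) ! + 2 ^ r * (suc k) !) (+-suc i j) ⟨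
    2 ^ r * (suc (suc i + j)) ! + 2 ^ r * (suc (i + suc j)) !
      ≤⟨ +-mono-≤ (beta-bound r (suc i) j (subst (_< M) (sym (+-suc r (i + j))) rij<M))
                  (beta-bound r i (suc j) (subst (_< M) (trans (sym (+-suc r (i + j))) (cong (_+_ r) (sym (+-suc i j)))) rij<M)) ⟩
    D * ((suc i) ! * j !) + D * (i ! * (suc j) !)
      ≡⟨ solve 5 (λ i j D s t → D :* ((con 1 :+ i) :* s :* t) :+ D :* (s :* ((con 1 :+ j) :* t)) := (con 2 :+ (i :+ j)) :* (D :* (s :* t))) refl i j D (i !) (j !) ⟩
    (2 + (i + j)) * (D * (i ! * j !)) ∎)
    where open ≤-Reasoning
          open ℕ-Solver

common-multiple-≥-2^ : ∀ D M → 0 < D → (∀ j → 0 < j → j ≤ suc M → j ∣ D) → 2 ^ M ≤ D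
common-multiple-≥-2^ D M D>0 multiple = begin
  2 ^ M            ≡⟨ *-identityʳ (2 ^ M) ⟨
  2 ^ M * 1        ≤⟨ beta-bound D (suc M) D>0 multiple M 0 0 (s≤s (≤-reflexive (+-identityʳ M))) ⟩
  D * 1            ≡⟨ *-identityʳ D ⟩
  D                ∎
  where open ≤-Reasoning

Smooth : ℕ → ℕ → Set
Smooth y j = ∀ q → Prime q → q ∣ j → q ≤ y

prime-factor : ∀ j → 2 ≤ j → ∃[ q ] (Prime q × q ∣ j)
prime-factor j 2≤j = go (factorise j {{>-nonZero (≤-trans z<s 2≤j)}})
  where
  go : PrimeFactorisation j → ∃[ q ] (Prime q × q ∣ j)
  go record { factors = []    ; isFactorisation = eq } = contradiction (subst (2 ≤_) eq 2≤j) λ { (s≤s ()) }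
  go record { factors = q ∷ qs ; isFactorisation = eq ; factorsPrime = q-prime ∷ _ } =
    q , q-prime , subst (q ∣_) (sym eq) (m∣m*n (product qs))

1-smooth⇒≡1 : ∀ {y j} → y ≤ 1 → 0 < j → Smooth y j → j ≡ 1
1-smooth⇒≡1 {j = suc zero}    y≤1 _ _ = refl
1-smooth⇒≡1 {j = suc (suc j)} y≤1 _ smooth =
  let q , q-prime , q∣j = prime-factor (suc (suc j)) (s≤s (s≤s z≤n))
  in contradiction (≤-trans (smooth q q-prime q∣j) y≤1) (<⇒≱ (nonTrivial⇒n>1 q {{prime⇒nonTrivial q-prime}}))

extract-power : ∀ i j → 2 ≤ i → 0 < j → ∃[ e ] ∃[ k ] (j ≡ k * i ^ e × ¬ i ∣ k)
extract-power i j 2≤i 0<j =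
  let e , divides k eq , i^1+e∤j = threshold (λ e → i ^ e ∣? j) (1∣ j) j (>⇒∤ {{>-nonZero 0<j}} (n<m^n 2≤i j))
  in e , k , eq , λ i∣k → i^1+e∤j (subst (i ^ suc e ∣_) (sym eq) (*-pres-∣ i∣k (∣-refl {i ^ e})))

-- D collects, for each i from 2 to y, the largest power of i up to M, at a cost of at most one
-- factor M. Composite i are treated like primes: after all powers of i are split off from an
-- i-smooth number, the cofactor is (i-1)-smooth, since i itself no longer divides it.
smooth-multiple : ∀ M → 0 < M → ∀ y → ∃[ D ] (0 < D × D ≤ M ^ y × (∀ j → 0 < j → j ≤ M → Smooth y j → j ∣ D))
smooth-multiple M 0<M zero = 1 , z<s , ≤-refl , λ j 0<j _ smooth → ∣-reflexive (1-smooth⇒≡1 z≤n 0<j smooth)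
smooth-multiple M 0<M (suc zero) = 1 , z<s , ≤-trans 0<M (≤-reflexive (sym (*-identityʳ M))) ,
  λ j 0<j _ smooth → ∣-reflexive (1-smooth⇒≡1 ≤-refl 0<j smooth)
smooth-multiple M 0<M (suc y@(suc _)) =
  let D , D>0 , D≤ , D-multiple = smooth-multiple M 0<M y
      i = suc y
      e , i^e≤M , i^1+e≰M = threshold (λ e → i ^ e ≤? M) 0<M M (<⇒≱ (n<m^n (s≤s (s≤s z≤n)) M))
  in D * i ^ e , *-mono-≤ D>0 (m^n>0 i e) , ≤-trans (*-mono-≤ D≤ i^e≤M) (≤-reflexive (*-comm (M ^ y) M)) ,
     λ j 0<j j≤M smooth →
       let f , k , eq , i∤k = extract-power i j (s≤s (s≤s z≤n)) 0<j
           instance j≢0 = >-nonZero 0<j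
           k∣j = subst (k ∣_) (sym eq) (m∣m*n (i ^ f))
           f≤e = ≮⇒≥ λ e<f → i^1+e≰M (≤-trans (^-monoʳ-≤ i {suc e} {f} e<f) (≤-trans (∣⇒≤ (divides k eq)) j≤M))
           k-smooth = λ q q-prime q∣k → ≤-pred (≤∧≢⇒< (smooth q q-prime (∣-trans q∣k k∣j)) λ q≡i → i∤k (subst (_∣ k) q≡i q∣k))
           k>0 = n≢0⇒n>0 λ k≡0 → i∤k (subst (i ∣_) (sym k≡0) (i ∣0))
       in subst (_∣ D * i ^ e) (sym eq) (*-pres-∣ (D-multiple k k>0 (≤-trans (∣⇒≤ k∣j) j≤M) k-smooth) (m≤n⇒a^m∣a^n {i} {f} {e} f≤e))
  where
  m≤n⇒a^m∣a^n : ∀ {a m n} → m ≤ n → a ^ m ∣ a ^ n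
  m≤n⇒a^m∣a^n {a} {m} {n} m≤n = divides (a ^ (n ∸ m))
    (trans (cong (a ^_) (sym (m∸n+n≡m m≤n))) (^-distribˡ-+-* a (n ∸ m) m))

-- Without such a prime all numbers up to M + 1 are y-smooth, and their common multiple from
-- `smooth-multiple` is below 2^M, against `common-multiple-≥-2^`.
prime-between : ∀ M y → suc M ^ y < 2 ^ M → ∃[ q ] (Prime q × y < q × q ≤ suc M)
prime-between M y M^y<2^M with anyUpTo? (λ q → prime? q ×-dec (y <? q)) (2 + M)
... | yes (q , q<2+M , q-prime , y<q) = q , q-prime , y<q , ≤-pred q<2+M
... | no none =
  let D , D>0 , D≤ , D-multiple = smooth-multiple (suc M) z<s y
      smooth = λ j 0<j j≤M q q-prime q∣j → ≮⇒≥ λ y<q →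
        none (q , s≤s (≤-trans (∣⇒≤ {{>-nonZero 0<j}} q∣j) j≤M) , q-prime , y<q)
  in contradiction (≤-<-trans D≤ M^y<2^M)
       (≤⇒≯ (common-multiple-≥-2^ D M D>0 λ j 0<j j≤M → D-multiple j 0<j j≤M (smooth j 0<j j≤M)))

c+t<2^t : ∀ c t → c < t → c + t < 2 ^ t
c+t<2^t c (suc t) (s≤s c≤t) = begin-strict
  c + suc t          ≤⟨ +-monoˡ-≤ (suc t) c≤t ⟩
  t + suc t          <⟨ +-mono-<-≤ (n<2^n t) (n<2^n t) ⟩
  2 ^ t + 2 ^ t      ≡⟨ cong (_+_ (2 ^ t)) (+-identityʳ (2 ^ t)) ⟨
  2 ^ suc t          ∎
  where open ≤-Reasoning

linear≤2^ : ∀ c q → c + c < q → c * suc q ≤ 2 ^ q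
linear≤2^ c q 2c<q = begin
  c * suc q          ≡⟨ cong (λ x → c * suc x) (m+[n∸m]≡n c≤q) ⟨
  c * suc (c + t)    ≤⟨ *-mono-≤ (<⇒≤ (n<2^n c)) (c+t<2^t c t (m+n≤o⇒m≤o∸n (suc c) 2c<q)) ⟩
  2 ^ c * 2 ^ t      ≡⟨ ^-distribˡ-+-* 2 c t ⟨
  2 ^ (c + t)        ≡⟨ cong (2 ^_) (m+[n∸m]≡n c≤q) ⟩
  2 ^ q              ∎
  where
  open ≤-Reasoning
  t = q ∸ c
  c≤q = ≤-trans (m≤m+n c c) (<⇒≤ 2c<q)

poly≤2^ : ∀ c e → ∃[ L₀ ] ∀ L → L₀ ≤ L → (c * L) ^ e ≤ 2 ^ L
poly≤2^ c zero    = 0 , λ L _ → m^n>0 2 L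
poly≤2^ c e@(suc _) = (2 + c′) * e , λ L L₀≤L →
  -- By L ≤ e(q+1) and (2^q)^e ≤ 2^L it suffices to compare e-th roots, that is, to show ce(q+1) ≤
  -- 2^q. The threshold (2 + 2ce)e ensures q > 2ce.
  let q = L ℕ./ e
      L≤e[1+q] : L ≤ e * suc q
      L≤e[1+q] = begin
        L                    ≡⟨ m≡m%n+[m/n]*n L e ⟩
        L % e + q * e        ≤⟨ +-monoˡ-≤ (q * e) (<⇒≤ (m%n<n L e)) ⟩
        e + q * e            ≡⟨ *-comm (suc q) e ⟩
        e * suc q            ∎
      c′<q : c * e + c * e < q
      c′<q = ≤-pred (*-cancelˡ-≤ e (≤-trans (≤-trans (≤-reflexive (*-comm e (2 + c′))) L₀≤L) L≤e[1+q]))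
  in begin
    (c * L) ^ e              ≤⟨ ^-monoˡ-≤ e (*-monoʳ-≤ c L≤e[1+q]) ⟩
    (c * (e * suc q)) ^ e    ≡⟨ cong (_^ e) (*-assoc c e (suc q)) ⟨
    (c * e * suc q) ^ e      ≤⟨ ^-monoˡ-≤ e (linear≤2^ (c * e) q c′<q) ⟩
    (2 ^ q) ^ e              ≡⟨ ^-*-assoc 2 q e ⟩
    2 ^ (q * e)              ≤⟨ ^-monoʳ-≤ 2 (m/n*n≤m L e) ⟩
    2 ^ L                    ∎
  where
  open ≤-Reasoning
  c′ = c * e + c * e

-- Take y just below (M-1)/(L+1). Then M^y ≤ 2^((L+1)y) < 2^(M-1), and a prime p > y loses only a
-- factor of order log M. The factor 2 pays for the step from M - 1 to M.
prime-near : ∀ M L → 2 ≤ M → M < 2 ^ suc L → ∃[ p ] (Prime p × p ≤ M × M ≤ 2 * suc L * p)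
prime-near (suc M) L (s≤s 0<M) M<2^[1+L] =
  let y , y-small , y-large = threshold (λ y → suc L * y <? M) (subst (_< M) (sym (*-zeroʳ L)) 0<M) M (≤⇒≯ (m≤n*m M (suc L)))
      p , p-prime , y<p , p≤M = prime-between M y (begin-strict
        suc M ^ y               ≤⟨ ^-monoˡ-≤ y (<⇒≤ M<2^[1+L]) ⟩
        (2 ^ suc L) ^ y         ≡⟨ ^-*-assoc 2 (suc L) y ⟩
        2 ^ (suc L * y)         <⟨ ^-monoʳ-< 2 ≤-refl y-small ⟩
        2 ^ M                   ∎)
      M≤[1+L]p = ≤-trans (≮⇒≥ y-large) (*-monoʳ-≤ (suc L) y<p)
  in p , p-prime , p≤M , (begin
    1 + M                       ≤⟨ +-mono-≤ (≤-trans 0<M M≤[1+L]p) M≤[1+L]p ⟩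
    suc L * p + suc L * p       ≡⟨ solve 2 (λ l p → l :* p :+ l :* p := con 2 :* l :* p) refl (suc L) p ⟩
    2 * suc L * p               ∎)
  where
  open ≤-Reasoning
  open ℕ-Solver

-- That is, p⁴ ≥ n^(1 - 1/J). With M the integer part of n^(1/4), the logarithmic loss of
-- `prime-near` remains at most n after being raised to the power 4J.
dense-primes : ∀ J → ∃[ N ] ∀ n → N ≤ n → ∃[ p ] (Prime p × p ^ 4 ≤ n × n ^ J ≤ p ^ (4 * J) * n)
dense-primes J = N , dense
  where
  open ≤-Reasoning
  -- The `suc` secures L ≥ 1, hence M ≥ 2 and 4(L+1) ≤ 8L.
  L₀ = suc (proj₁ (poly≤2^ 16 (4 * J)))
  N = (2 ^ L₀) ^ 4

  module _ (n : ℕ) (N≤n : N ≤ n) where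
    root = threshold (λ M → M ^ 4 ≤? n) z≤n (suc n) (<⇒≱ (m≤m*n (suc n) (suc n ^ 3) {{m^n≢0 (suc n) 3}}))
    M = proj₁ root
    M^4≤n = proj₁ (proj₂ root)
    n<[1+M]^4 = ≰⇒> (proj₂ (proj₂ root))

    2^L₀≤M : 2 ^ L₀ ≤ M
    2^L₀≤M = ≮⇒≥ λ M<2^L₀ → <⇒≱ n<[1+M]^4 (≤-trans (^-monoˡ-≤ 4 M<2^L₀) N≤n)

    log = threshold (λ L → 2 ^ L ≤? M) (≤-trans (m^n>0 2 L₀) 2^L₀≤M) M (<⇒≱ (n<2^n M))
    L = proj₁ log
    2^L≤M = proj₁ (proj₂ log)
    M<2^[1+L] = ≰⇒> (proj₂ (proj₂ log))

    L₀≤L : L₀ ≤ L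
    L₀≤L = ≮⇒≥ λ L<L₀ → <⇒≱ M<2^[1+L] (≤-trans (^-monoʳ-≤ 2 L<L₀) 2^L₀≤M)

    2≤M : 2 ≤ M
    2≤M = ≤-trans (^-monoʳ-≤ 2 {1} {L₀} (s≤s z≤n)) 2^L₀≤M

    dense : ∃[ p ] (Prime p × p ^ 4 ≤ n × n ^ J ≤ p ^ (4 * J) * n)
    dense =
      let p , p-prime , p≤M , M≤ = prime-near M L 2≤M M<2^[1+L]
      in p , p-prime , ≤-trans (^-monoˡ-≤ 4 p≤M) M^4≤n , (begin
        n ^ J                                   ≤⟨ ^-monoˡ-≤ J (<⇒≤ n<[1+M]^4) ⟩
        (suc M ^ 4) ^ J                         ≡⟨ ^-*-assoc (suc M) 4 J ⟩
        suc M ^ (4 * J)                         ≤⟨ ^-monoˡ-≤ (4 * J) (begin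
            1 + M                                 ≤⟨ +-monoˡ-≤ M (<⇒≤ 2≤M) ⟩
            M + M                                 ≤⟨ +-mono-≤ M≤ M≤ ⟩
            2 * suc L * p + 2 * suc L * p         ≤⟨ ≤-reflexive (solve 2 (λ l p → con 2 :* l :* p :+ con 2 :* l :* p := p :* (con 4 :* l)) refl (suc L) p) ⟩
            p * (4 * suc L)                       ≤⟨ *-monoʳ-≤ p (begin
              4 * suc L                             ≡⟨ solve 1 (λ l → con 4 :* (con 1 :+ l) := con 4 :* con 1 :+ con 4 :* l) refl L ⟩
              4 * 1 + 4 * L                         ≤⟨ +-monoˡ-≤ (4 * L) (*-monoʳ-≤ 4 (≤-trans (s≤s z≤n) L₀≤L)) ⟩
              4 * L + 4 * L                         ≤⟨ ≤-reflexive (solve 1 (λ l → con 4 :* l :+ con 4 :* l := con 8 :* l) refl L) ⟩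
              8 * L                                 ≤⟨ *-monoˡ-≤ L (m≤m+n 8 8) ⟩
              16 * L                                ∎) ⟩
            p * (16 * L)                          ∎) ⟩
        (p * (16 * L)) ^ (4 * J)                ≡⟨ ^-distribʳ-* (4 * J) p (16 * L) ⟩
        p ^ (4 * J) * (16 * L) ^ (4 * J)        ≤⟨ *-monoʳ-≤ (p ^ (4 * J)) (begin
            (16 * L) ^ (4 * J)                    ≤⟨ proj₂ (poly≤2^ 16 (4 * J)) L (≤-trans (n≤1+n _) L₀≤L) ⟩
            2 ^ L                                 ≤⟨ 2^L≤M ⟩
            M                                     ≤⟨ m≤m*n M (M ^ 3) {{m^n≢0 M 3 {{>-nonZero (<⇒≤ 2≤M)}}}} ⟩
            M ^ 4                                 ≤⟨ M^4≤n ⟩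
            n                                     ∎) ⟩
        p ^ (4 * J) * n                         ∎)
      where open ℕ-Solver

-- The upper bound

∑-mono : ∀ {n} {f g : Fin n → ℕ} → (∀ i → f i ≤ g i) → ∑[ i < n ] f i ≤ ∑[ i < n ] g i
∑-mono {zero}  f≤g = z≤n
∑-mono {suc n} f≤g = +-mono-≤ (f≤g zero) (∑-mono (f≤g ∘ suc))

∑-const : ∀ n c → ∑[ i < n ] c ≡ n * c
∑-const zero    c = refl
∑-const (suc n) c = cong (_+_ c) (∑-const n c)

∑-≤ : ∀ {n} {f : Fin n → ℕ} c → (∀ i → f i ≤ c) → ∑[ i < n ] f i ≤ n * c
∑-≤ {n} c f≤c = ≤-trans (∑-mono f≤c) (≤-reflexive (∑-const n c))

∑-≤-except : ∀ {n} {f : Fin n → ℕ} i b c → f i ≤ b → (∀ j → i ≢ j → f j ≤ c) → ∑[ j < n ] f j ≤ b + n * c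
∑-≤-except {suc n} zero    b c fi≤b f≤c = +-mono-≤ fi≤b
  (≤-trans (∑-≤ c λ j → f≤c (suc j) λ ()) (m≤n+m (n * c) c))
∑-≤-except {suc n} {f} (suc i) b c fi≤b f≤c = begin
  f zero + ∑[ j < n ] f (suc j)  ≤⟨ +-mono-≤ (f≤c zero λ ()) (∑-≤-except i b c fi≤b λ j i≢j → f≤c (suc j) (i≢j ∘ suc-injective)) ⟩
  c + (b + n * c)                ≡⟨ solve 3 (λ b c t → c :+ (b :+ t) := b :+ (c :+ t)) refl b c (n * c) ⟩
  b + (c + n * c)                ∎
  where open ≤-Reasoning
        open ℕ-Solver

∑-++ : ∀ m {n} (f : Fin (m + n) → ℕ) → sum f ≡ ∑[ i < m ] f (i ↑ˡ n) + ∑[ j < n ] f (m ↑ʳ j)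
∑-++ zero    f = refl
∑-++ (suc m) f = trans (cong (_+_ (f zero)) (∑-++ m (f ∘ suc))) (sym (+-assoc (f zero) _ _))

∑-combine : ∀ m {n} (f : Fin (m * n) → ℕ) → sum f ≡ ∑[ i < m ] ∑[ j < n ] f (combine i j)
∑-combine zero    f = refl
∑-combine (suc m) {n} f = trans (∑-++ n f) (cong (_+_ (∑[ j < n ] f (j ↑ˡ (m * n)))) (∑-combine m (f ∘ (n ↑ʳ_))))

∑-* : ∀ {m n} (f : Fin m → ℕ) (g : Fin n → ℕ) → sum f * sum g ≡ ∑[ i < m ] ∑[ j < n ] (f i * g j)
∑-* f g = trans (*-distribʳ-sum (sum g) f) (sum-cong-≗ λ i → *-distribˡ-sum (f i) g)

2mn≤m²+n² : ∀ m n → m * n + m * n ≤ m * m + n * n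
2mn≤m²+n² zero    n       = z≤n
2mn≤m²+n² (suc m) zero    = ≤-trans (≤-reflexive (cong₂ _+_ (*-zeroʳ m) (*-zeroʳ m))) z≤n
2mn≤m²+n² (suc m) (suc n) = begin
  suc m * suc n + suc m * suc n            ≡⟨ solve 2 (λ m n →
      (con 1 :+ m) :* (con 1 :+ n) :+ (con 1 :+ m) :* (con 1 :+ n) :=
      (m :* n :+ m :* n) :+ (con 2 :* m :+ con 2 :* n :+ con 2)) refl m n ⟩
  (m * n + m * n) + (2 * m + 2 * n + 2)    ≤⟨ +-monoˡ-≤ _ (2mn≤m²+n² m n) ⟩
  (m * m + n * n) + (2 * m + 2 * n + 2)    ≡⟨ solve 2 (λ m n →
      (m :* m :+ n :* n) :+ (con 2 :* m :+ con 2 :* n :+ con 2) :=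
      (con 1 :+ m) :* (con 1 :+ m) :+ (con 1 :+ n) :* (con 1 :+ n)) refl m n ⟩
  suc m * suc m + suc n * suc n            ∎
  where open ≤-Reasoning
        open ℕ-Solver

cauchy-schwarz : ∀ {n} (f : Fin n → ℕ) → sum f * sum f ≤ n * ∑[ i < n ] (f i * f i)
cauchy-schwarz {n} f = *-cancelˡ-≤ 2 (begin
  2 * (sum f * sum f)
    ≡⟨ cong (2 *_) (∑-* f f) ⟩
  2 * ∑[ i < n ] ∑[ j < n ] (f i * f j)
    ≡⟨ trans (*-distribˡ-sum 2 (λ i → ∑[ j < n ] (f i * f j))) (sum-cong-≗ λ i → *-distribˡ-sum 2 (λ j → f i * f j)) ⟩
  ∑[ i < n ] ∑[ j < n ] (2 * (f i * f j))
    ≤⟨ ∑-mono (λ i → ∑-mono λ j → ≤-trans (≤-reflexive (cong (_+_ (f i * f j)) (+-identityʳ _))) (2mn≤m²+n² (f i) (f j))) ⟩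
  ∑[ i < n ] ∑[ j < n ] (f i * f i + f j * f j)
    ≡⟨ sum-cong-≗ (λ i → trans (∑-distrib-+ (λ _ → f i * f i) (λ j → f j * f j)) (cong (_+ Q) (∑-const n (f i * f i)))) ⟩
  ∑[ i < n ] (n * (f i * f i) + Q)
    ≡⟨ trans (∑-distrib-+ (λ i → n * (f i * f i)) (λ _ → Q)) (cong₂ _+_ (sym (*-distribˡ-sum n (λ i → f i * f i))) (∑-const n Q)) ⟩
  n * Q + n * Q
    ≡⟨ cong (_+_ (n * Q)) (+-identityʳ (n * Q)) ⟨
  2 * (n * Q) ∎)
  where
  open ≤-Reasoning
  Q = ∑[ i < n ] (f i * f i)

indicator : Bool → ℕ
indicator true  = 1
indicator false = 0

indicator-∧ : ∀ a b → indicator (a ∧ b) ≡ indicator a * indicator b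
indicator-∧ true  b = sym (+-identityʳ (indicator b))
indicator-∧ false b = refl

∣∣≡∑ : ∀ {n} (S : Subset n) → ∣ S ∣ ≡ ∑[ i < n ] indicator (lookup S i)
∣∣≡∑ []          = refl
∣∣≡∑ (true ∷ S)  = cong suc (∣∣≡∑ S)
∣∣≡∑ (false ∷ S) = ∣∣≡∑ S

∣tabulate∣ : ∀ {n} (f : Fin n → Bool) → ∣ tabulate f ∣ ≡ ∑[ i < n ] indicator (f i)
∣tabulate∣ f = trans (∣∣≡∑ (tabulate f)) (sum-cong-≗ λ i → cong indicator (lookup∘tabulate f i))

subset-of-size : ∀ {n} (S : Subset n) k → k ≤ ∣ S ∣ → ∃[ T ] (∣ T ∣ ≡ k × (∀ {x} → x ∈ T → x ∈ S))
subset-of-size []          zero    k≤ = [] , refl , λ ()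
subset-of-size (false ∷ S) k       k≤ =
  let T , ∣T∣ , T⊆S = subset-of-size S k k≤ in false ∷ T , ∣T∣ , λ { (there x∈) → there (T⊆S x∈) }
subset-of-size (true ∷ S) zero    k≤ =
  let T , ∣T∣ , T⊆S = subset-of-size S zero z≤n in false ∷ T , ∣T∣ , λ { (there x∈) → there (T⊆S x∈) }
subset-of-size (true ∷ S) (suc k) k≤ =
  let T , ∣T∣ , T⊆S = subset-of-size S k (≤-pred k≤)
  in true ∷ T , cong suc ∣T∣ , λ { here → here ; (there x∈) → there (T⊆S x∈) }

pair : ∀ {n} (x y : Fin n) → x ≢ y → ∃[ S ] (∣ S ∣ ≡ 2 × (∀ z → z ∈ S → z ≡ x ⊎ z ≡ y))
pair zero    zero    x≢y = contradiction refl x≢y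
pair zero    (suc y) x≢y = true ∷ ⁅ y ⁆ , cong suc (∣⁅x⁆∣≡1 y) ,
  λ { zero _ → inj₁ refl ; (suc z) (there z∈) → inj₂ (cong suc (x∈⁅y⁆⇒x≡y y z∈)) }
pair (suc x) zero    x≢y = true ∷ ⁅ x ⁆ , cong suc (∣⁅x⁆∣≡1 x) ,
  λ { zero _ → inj₂ refl ; (suc z) (there z∈) → inj₁ (cong suc (x∈⁅y⁆⇒x≡y x z∈)) }
pair (suc x) (suc y) x≢y =
  let S , ∣S∣ , S⊆ = pair x y (x≢y ∘ cong suc)
  in false ∷ S , ∣S∣ , λ { (suc z) (there z∈) → Sum.map (cong suc) (cong suc) (S⊆ z z∈) }

edge? : ∀ {n} → Hypergraph n → Fin n → Fin n → Fin n → Bool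
edge? H x y z = lookup (edges H) (combine x (combine y z))

#edges≡∑ : ∀ {n} (H : Hypergraph n) → #edges H ≡ ∑[ x < n ] ∑[ y < n ] ∑[ z < n ] indicator (edge? H x y z)
#edges≡∑ {n} H = trans (∣∣≡∑ (edges H)) (trans (∑-combine n _) (sum-cong-≗ {n} λ x → ∑-combine n _))

-- Two applications of Cauchy–Schwarz reduce the edge count to the number of
-- homomorphic copies of K(2,2,1).
module _ {n : ℕ} (f : Fin n → Fin n → Fin n → ℕ) where
  open ≤-Reasoning
  open ℕ-Solver

  K₂₂₁-weight : Fin n → Fin n → Fin n → Fin n → ℕ
  K₂₂₁-weight x x′ y y′ = ∑[ z < n ] ((f x y z * f x′ y z) * (f x y′ z * f x′ y′ z))

  private
    E = ∑[ x < n ] ∑[ y < n ] ∑[ z < n ] f x y z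
    T = ∑[ x < n ] ∑[ x′ < n ] ∑[ y < n ] ∑[ y′ < n ] K₂₂₁-weight x x′ y y′
    h : Fin n → Fin n → Fin n → ℕ
    h x x′ z = ∑[ y < n ] (f x y z * f x′ y z)
    S = ∑[ x < n ] ∑[ x′ < n ] ∑[ z < n ] h x x′ z

    d : Fin n → Fin n → ℕ
    d y z = ∑[ x < n ] f x y z

    cauchy² : (g : Fin n → Fin n → ℕ) → (∑[ y < n ] ∑[ z < n ] g y z) * (∑[ y < n ] ∑[ z < n ] g y z)
      ≤ n ^ 2 * ∑[ y < n ] ∑[ z < n ] (g y z * g y z)
    cauchy² g = begin
      (∑[ y < n ] ∑[ z < n ] g y z) * (∑[ y < n ] ∑[ z < n ] g y z)   ≤⟨ cauchy-schwarz (λ y → ∑[ z < n ] g y z) ⟩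
      n * ∑[ y < n ] ((∑[ z < n ] g y z) * (∑[ z < n ] g y z))        ≤⟨ *-monoʳ-≤ n (∑-mono λ y → cauchy-schwarz (g y)) ⟩
      n * ∑[ y < n ] (n * ∑[ z < n ] (g y z * g y z))                 ≡⟨ cong (n *_) (*-distribˡ-sum n (λ y → ∑[ z < n ] (g y z * g y z))) ⟨
      n * (n * ∑[ y < n ] ∑[ z < n ] (g y z * g y z))                 ≡⟨ solve 2 (λ n q → n :* (n :* q) := n :^ 2 :* q) refl n (∑[ y < n ] ∑[ z < n ] (g y z * g y z)) ⟩
      n ^ 2 * ∑[ y < n ] ∑[ z < n ] (g y z * g y z)                   ∎

    E≡∑d : E ≡ ∑[ y < n ] ∑[ z < n ] d y z
    E≡∑d = trans (∑-comm (λ x y → ∑[ z < n ] f x y z)) (sum-cong-≗ λ y → ∑-comm (λ x z → f x y z))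

    ∑d²≡S : ∑[ y < n ] ∑[ z < n ] (d y z * d y z) ≡ S
    ∑d²≡S = begin-equality
      ∑[ y < n ] ∑[ z < n ] (d y z * d y z)
        ≡⟨ sum-cong-≗ (λ y → sum-cong-≗ λ z → ∑-* (λ x → f x y z) (λ x → f x y z)) ⟩
      ∑[ y < n ] ∑[ z < n ] ∑[ x < n ] ∑[ x′ < n ] (f x y z * f x′ y z)
        ≡⟨ ∑-comm (λ y z → ∑[ x < n ] ∑[ x′ < n ] (f x y z * f x′ y z)) ⟩
      ∑[ z < n ] ∑[ y < n ] ∑[ x < n ] ∑[ x′ < n ] (f x y z * f x′ y z)
        ≡⟨ sum-cong-≗ (λ z → ∑-comm (λ y x → ∑[ x′ < n ] (f x y z * f x′ y z))) ⟩
      ∑[ z < n ] ∑[ x < n ] ∑[ y < n ] ∑[ x′ < n ] (f x y z * f x′ y z)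
        ≡⟨ ∑-comm (λ z x → ∑[ y < n ] ∑[ x′ < n ] (f x y z * f x′ y z)) ⟩
      ∑[ x < n ] ∑[ z < n ] ∑[ y < n ] ∑[ x′ < n ] (f x y z * f x′ y z)
        ≡⟨ sum-cong-≗ (λ x → sum-cong-≗ λ z → ∑-comm (λ y x′ → f x y z * f x′ y z)) ⟩
      ∑[ x < n ] ∑[ z < n ] ∑[ x′ < n ] h x x′ z
        ≡⟨ sum-cong-≗ (λ x → ∑-comm (λ z x′ → h x x′ z)) ⟩
      S ∎

    ∑h²≡T : ∑[ x < n ] ∑[ x′ < n ] ∑[ z < n ] (h x x′ z * h x x′ z) ≡ T
    ∑h²≡T = sum-cong-≗ λ x → sum-cong-≗ λ x′ → begin-equality
      ∑[ z < n ] (h x x′ z * h x x′ z)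
        ≡⟨ sum-cong-≗ (λ z → ∑-* (λ y → f x y z * f x′ y z) (λ y → f x y z * f x′ y z)) ⟩
      ∑[ z < n ] ∑[ y < n ] ∑[ y′ < n ] ((f x y z * f x′ y z) * (f x y′ z * f x′ y′ z))
        ≡⟨ ∑-comm (λ z y → ∑[ y′ < n ] ((f x y z * f x′ y z) * (f x y′ z * f x′ y′ z))) ⟩
      ∑[ y < n ] ∑[ z < n ] ∑[ y′ < n ] ((f x y z * f x′ y z) * (f x y′ z * f x′ y′ z))
        ≡⟨ sum-cong-≗ (λ y → ∑-comm (λ z y′ → (f x y z * f x′ y z) * (f x y′ z * f x′ y′ z))) ⟩
      ∑[ y < n ] ∑[ y′ < n ] K₂₂₁-weight x x′ y y′ ∎

    -- Cauchy-Schwarz over the n² pairs (y, z) duplicates x. In `S²≤n³T` the n³ triples (x, x′, z)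
    -- serve to duplicate y.
    E²≤n²S : E * E ≤ n ^ 2 * S
    E²≤n²S = begin
      E * E                                                            ≡⟨ cong₂ _*_ E≡∑d E≡∑d ⟩
      (∑[ y < n ] ∑[ z < n ] d y z) * (∑[ y < n ] ∑[ z < n ] d y z)    ≤⟨ cauchy² d ⟩
      n ^ 2 * ∑[ y < n ] ∑[ z < n ] (d y z * d y z)                    ≡⟨ cong (n ^ 2 *_) ∑d²≡S ⟩
      n ^ 2 * S                                                        ∎

    S²≤n³T : S * S ≤ n ^ 3 * T
    S²≤n³T = begin
      S * S
        ≤⟨ cauchy-schwarz (λ x → ∑[ x′ < n ] ∑[ z < n ] h x x′ z) ⟩
      n * ∑[ x < n ] ((∑[ x′ < n ] ∑[ z < n ] h x x′ z) * (∑[ x′ < n ] ∑[ z < n ] h x x′ z))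
        ≤⟨ *-monoʳ-≤ n (∑-mono λ x → cauchy² (h x)) ⟩
      n * ∑[ x < n ] (n ^ 2 * ∑[ x′ < n ] ∑[ z < n ] (h x x′ z * h x x′ z))
        ≡⟨ cong (n *_) (*-distribˡ-sum (n ^ 2) (λ x → ∑[ x′ < n ] ∑[ z < n ] (h x x′ z * h x x′ z))) ⟨
      n * (n ^ 2 * ∑[ x < n ] ∑[ x′ < n ] ∑[ z < n ] (h x x′ z * h x x′ z))
        ≡⟨ cong (λ q → n * (n ^ 2 * q)) ∑h²≡T ⟩
      n * (n ^ 2 * T)
        ≡⟨ *-assoc n (n ^ 2) T ⟨
      n ^ 3 * T ∎

  edges⁴≤n⁷-K₂₂₁ : E ^ 4 ≤ n ^ 7 * T
  edges⁴≤n⁷-K₂₂₁ = begin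
    E ^ 4                            ≡⟨ solve 1 (λ e → e :^ 4 := (e :* e) :* (e :* e)) refl E ⟩
    (E * E) * (E * E)                ≤⟨ *-mono-≤ E²≤n²S E²≤n²S ⟩
    (n ^ 2 * S) * (n ^ 2 * S)        ≡⟨ solve 2 (λ n s → (n :^ 2 :* s) :* (n :^ 2 :* s) := n :^ 4 :* (s :* s)) refl n S ⟩
    n ^ 4 * (S * S)                  ≤⟨ *-monoʳ-≤ (n ^ 4) S²≤n³T ⟩
    n ^ 4 * (n ^ 3 * T)              ≡⟨ solve 2 (λ n t → n :^ 4 :* (n :^ 3 :* t) := n :^ 7 :* t) refl n T ⟩
    n ^ 7 * T                        ∎

module _ {n : ℕ} (H : Hypergraph n) (free : KFree 2 2 7 H) where
  private
    f : Fin n → Fin n → Fin n → ℕ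
    f x y z = indicator (edge? H x y z)

    common? : Fin n → Fin n → Fin n → Fin n → Fin n → Bool
    common? x x′ y y′ z = (edge? H x y z ∧ edge? H x′ y z) ∧ (edge? H x y′ z ∧ edge? H x′ y′ z)

    weight≡ : ∀ x x′ y y′ → K₂₂₁-weight f x x′ y y′ ≡ ∣ tabulate (common? x x′ y y′) ∣
    weight≡ x x′ y y′ = sym (trans (∣tabulate∣ (common? x x′ y y′)) (sum-cong-≗ λ z →
      trans (indicator-∧ (edge? H x y z ∧ edge? H x′ y z) (edge? H x y′ z ∧ edge? H x′ y′ z))
        (cong₂ _*_ (indicator-∧ (edge? H x y z) (edge? H x′ y z)) (indicator-∧ (edge? H x y′ z) (edge? H x′ y′ z)))))

    weight≤n : ∀ x x′ y y′ → K₂₂₁-weight f x x′ y y′ ≤ n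
    weight≤n x x′ y y′ = ≤-trans (≤-reflexive (trans (weight≡ x x′ y y′) (∣tabulate∣ (common? x x′ y y′))))
      (≤-trans (∑-≤ 1 λ z → indicator≤1 (common? x x′ y y′ z)) (≤-reflexive (*-identityʳ n)))
      where
      indicator≤1 : ∀ b → indicator b ≤ 1
      indicator≤1 true  = ≤-refl
      indicator≤1 false = z≤n

    weight≤6 : ∀ x x′ y y′ → x ≢ x′ → y ≢ y′ → K₂₂₁-weight f x x′ y y′ ≤ 6
    weight≤6 x x′ y y′ x≢x′ y≢y′ = ≮⇒≥ λ 6<weight →
      let S₁ , ∣S₁∣ , S₁⊆ = pair x x′ x≢x′
          S₂ , ∣S₂∣ , S₂⊆ = pair y y′ y≢y′
          S₃ , ∣S₃∣ , S₃⊆ = subset-of-size (tabulate (common? x x′ y y′)) 7 (≤-trans 6<weight (≤-reflexive (weight≡ x x′ y y′)))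
      in free (S₁ , S₂ , S₃ , ∣S₁∣ , ∣S₂∣ , ∣S₃∣ , λ u v z u∈ v∈ z∈ →
        edge (S₁⊆ u u∈) (S₂⊆ v v∈) (trans (sym (lookup∘tabulate (common? x x′ y y′) z)) ([]=⇒lookup (S₃⊆ z∈))))
      where
      edge : ∀ {u v z} → u ≡ x ⊎ u ≡ x′ → v ≡ y ⊎ v ≡ y′ → common? x x′ y y′ z ≡ true → Edge H u v z
      edge {z = z} u≡ v≡ c = lookup⇒[]= _ _ (case u≡ v≡)
        where
        left  = ∧-conicalˡ (edge? H x y z ∧ edge? H x′ y z) (edge? H x y′ z ∧ edge? H x′ y′ z) c
        right = ∧-conicalʳ (edge? H x y z ∧ edge? H x′ y z) (edge? H x y′ z ∧ edge? H x′ y′ z) c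
        case : ∀ {u v} → u ≡ x ⊎ u ≡ x′ → v ≡ y ⊎ v ≡ y′ → edge? H u v z ≡ true
        case (inj₁ refl) (inj₁ refl) = ∧-conicalˡ (edge? H x y z) (edge? H x′ y z) left
        case (inj₂ refl) (inj₁ refl) = ∧-conicalʳ (edge? H x y z) (edge? H x′ y z) left
        case (inj₁ refl) (inj₂ refl) = ∧-conicalˡ (edge? H x y′ z) (edge? H x′ y′ z) right
        case (inj₂ refl) (inj₂ refl) = ∧-conicalʳ (edge? H x y′ z) (edge? H x′ y′ z) right

    -- The origin of 8 = 1 + 1 + 6: x = x′ and y = y′ account for n³ quadruples each, of weight at
    -- most n, and all others have weight at most 6.
    total≤ : ∑[ x < n ] ∑[ x′ < n ] ∑[ y < n ] ∑[ y′ < n ] K₂₂₁-weight f x x′ y y′ ≤ n * (n * (n * n) + n * (n * (n + n * 6)))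
    total≤ = ∑-≤ _ λ x → ∑-≤-except x _ _
      (∑-≤ _ λ y → ∑-≤ _ λ y′ → weight≤n x x y y′)
      λ x′ x≢x′ → ∑-≤ _ λ y → ∑-≤-except y _ _ (weight≤n x x′ y y)
        λ y′ y≢y′ → weight≤6 x x′ y y′ x≢x′ y≢y′

  KFree⇒#edges⁴≤8n¹¹ : #edges H ^ 4 ≤ 8 * n ^ 11
  KFree⇒#edges⁴≤8n¹¹ = begin
    #edges H ^ 4       ≡⟨ cong (_^ 4) (#edges≡∑ H) ⟩
    _                  ≤⟨ edges⁴≤n⁷-K₂₂₁ f ⟩
    n ^ 7 * _          ≤⟨ *-monoʳ-≤ (n ^ 7) total≤ ⟩
    n ^ 7 * (n * (n * (n * n) + n * (n * (n + n * 6))))  ≡⟨ solve 1 (λ n → n :^ 7 :* (n :* (n :* (n :* n) :+ n :* (n :* (n :+ n :* con 6)))) := con 8 :* n :^ 11) refl n ⟩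
    8 * n ^ 11         ∎
    where open ≤-Reasoning
          open ℕ-Solver

-- From relations to hypergraphs

enumerate : ∀ {n} (S : Subset n) → Σ (Fin ∣ S ∣ → Fin n) λ e → ((∀ {i j} → e i ≡ e j → i ≡ j) × (∀ i → e i ∈ S))
enumerate []          = (λ ()) , (λ { {()} }) , λ ()
enumerate (false ∷ S) =
  let e , e-injective , e∈S = enumerate S in suc ∘ e , e-injective ∘ suc-injective , there ∘ e∈S
enumerate (true ∷ S)  =
  let e , e-injective , e∈S = enumerate S
  in (λ { zero → zero ; (suc i) → suc (e i) }) ,
     (λ { {zero} {zero} _ → refl ; {suc i} {suc j} eq → cong suc (e-injective (suc-injective eq)) }) ,
     λ { zero → here ; (suc i) → there (e∈S i) }

∑-inject≤ : ∀ {k n} (k≤n : k ≤ n) (f : Fin n → ℕ) → ∑[ i < k ] f (inject≤ i k≤n) ≤ sum f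
∑-inject≤ {zero}          k≤n       f = z≤n
∑-inject≤ {suc k} {suc n} (s≤s k≤n) f = +-monoʳ-≤ (f zero) (∑-inject≤ k≤n (f ∘ suc))

-- The default `false` makes the vertices that fill a part up to size n isolated, so they enter no
-- copy of K(2,2,7).
extend : ∀ {k n} → (Fin k → Bool) → Fin n → Bool
extend {zero}          f x       = false
extend {suc k} {suc n} f zero    = f zero
extend {suc k} {suc n} f (suc x) = extend (f ∘ suc) x

extend-inject≤ : ∀ {k n} (k≤n : k ≤ n) (f : Fin k → Bool) i → extend f (inject≤ i k≤n) ≡ f i
extend-inject≤ {suc k} {suc n} (s≤s k≤n) f zero    = refl
extend-inject≤ {suc k} {suc n} (s≤s k≤n) f (suc i) = extend-inject≤ k≤n (f ∘ suc) i

extend-true : ∀ {k n} (f : Fin k → Bool) (x : Fin n) → extend f x ≡ true → ∃[ i ] (toℕ i ≡ toℕ x × f i ≡ true)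
extend-true {suc k} {suc n} f zero    eq = zero , refl , eq
extend-true {suc k} {suc n} f (suc x) eq =
  let i , i≡x , fi = extend-true (f ∘ suc) x eq in suc i , cong suc i≡x , fi

-- A copy of K(2,2,7) with indexed sides, as the algebra wants its vertices, in parts that need not
-- have equal sizes.
record Grid {a b c} (R : Fin a → Fin b → Fin c → Bool) : Set where
  field
    x : Fin 2 → Fin a
    y : Fin 2 → Fin b
    z : Fin 7 → Fin c
    x-injective : ∀ i j → x i ≡ x j → i ≡ j
    y-injective : ∀ i j → y i ≡ y j → i ≡ j
    z-injective : ∀ i j → z i ≡ z j → i ≡ j
    edge        : ∀ i j k → R (x i) (y j) (z k) ≡ true

module _ {n a b c : ℕ} (a≤n : a ≤ n) (b≤n : b ≤ n) (c≤n : c ≤ n) (R : Fin a → Fin b → Fin c → Bool) where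
  private
    R⁺ : Fin n → Fin n → Fin n → Bool
    R⁺ x y z = extend (λ i → extend (λ j → extend (R i j) z) y) x

    H : Hypergraph n
    H = hypergraph (tabulate λ e → let x , yz = remQuot (n * n) e ; y , z = remQuot n yz in R⁺ x y z)

    edge?-H : ∀ x y z → edge? H x y z ≡ R⁺ x y z
    edge?-H x y z = trans (lookup∘tabulate _ (combine x (combine y z)))
      (trans (cong (λ (u , vw) → let v , w = remQuot n vw in R⁺ u v w) (remQuot-combine x (combine y z)))
             (cong (λ (v , w) → R⁺ x v w) (remQuot-combine y z)))

    edges-H : ∑[ i < a ] ∑[ j < b ] ∑[ k < c ] indicator (R i j k) ≤ #edges H
    edges-H = begin
      ∑[ i < a ] ∑[ j < b ] ∑[ k < c ] indicator (R i j k)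
        ≡⟨ sum-cong-≗ (λ i → sum-cong-≗ λ j → sum-cong-≗ λ k → cong indicator (restrict i j k)) ⟩
      ∑[ i < a ] ∑[ j < b ] ∑[ k < c ] indicator (edge? H (inject≤ i a≤n) (inject≤ j b≤n) (inject≤ k c≤n))
        ≤⟨ ∑-mono (λ i → ∑-mono λ j → ∑-inject≤ c≤n (λ z → indicator (edge? H (inject≤ i a≤n) (inject≤ j b≤n) z))) ⟩
      ∑[ i < a ] ∑[ j < b ] ∑[ z < n ] indicator (edge? H (inject≤ i a≤n) (inject≤ j b≤n) z)
        ≤⟨ ∑-mono (λ i → ∑-inject≤ b≤n (λ y → ∑[ z < n ] indicator (edge? H (inject≤ i a≤n) y z))) ⟩
      ∑[ i < a ] ∑[ y < n ] ∑[ z < n ] indicator (edge? H (inject≤ i a≤n) y z)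
        ≤⟨ ∑-inject≤ a≤n (λ x → ∑[ y < n ] ∑[ z < n ] indicator (edge? H x y z)) ⟩
      ∑[ x < n ] ∑[ y < n ] ∑[ z < n ] indicator (edge? H x y z)
        ≡⟨ #edges≡∑ H ⟨
      #edges H ∎
      where
      open ≤-Reasoning
      restrict : ∀ i j k → R i j k ≡ edge? H (inject≤ i a≤n) (inject≤ j b≤n) (inject≤ k c≤n)
      restrict i j k = sym (trans (edge?-H _ _ _) (trans (extend-inject≤ a≤n _ i) (trans (extend-inject≤ b≤n _ j) (extend-inject≤ c≤n (R i j) k))))

    H-edge : ∀ x y z → Edge H x y z →
      Σ (Fin a) λ i → Σ (Fin b) λ j → Σ (Fin c) λ k → (toℕ i ≡ toℕ x × toℕ j ≡ toℕ y × toℕ k ≡ toℕ z × R i j k ≡ true)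
    H-edge x y z e =
      let i , i≡x , ei = extend-true (λ i → extend (λ j → extend (R i j) z) y) x (trans (sym (edge?-H x y z)) ([]=⇒lookup e))
          j , j≡y , ej = extend-true (λ j → extend (R i j) z) y ei
          k , k≡z , ek = extend-true (R i j) z ej
      in i , j , k , i≡x , j≡y , k≡z , ek

    grid : ∀ (e₁ e₂ : Fin 2 → Fin n) (e₃ : Fin 7 → Fin n) →
      (∀ {i j} → e₁ i ≡ e₁ j → i ≡ j) → (∀ {i j} → e₂ i ≡ e₂ j → i ≡ j) → (∀ {i j} → e₃ i ≡ e₃ j → i ≡ j) →
      (∀ i j k → Edge H (e₁ i) (e₂ j) (e₃ k)) → Grid R
    grid e₁ e₂ e₃ e₁-injective e₂-injective e₃-injective e =
      record { x = x ; y = y ; z = z ; x-injective = x-injective ; y-injective = y-injective ; z-injective = z-injective ; edge = all-edges }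
      where
      -- Preimages are only available through edges. Each vertex takes its preimage from one fixed
      -- edge; the other edges give the same one, because `toℕ` determines it.
      x : Fin 2 → Fin a
      x i = proj₁ (H-edge (e₁ i) (e₂ zero) (e₃ zero) (e i zero zero))
      y : Fin 2 → Fin b
      y j = proj₁ (proj₂ (H-edge (e₁ zero) (e₂ j) (e₃ zero) (e zero j zero)))
      z : Fin 7 → Fin c
      z k = proj₁ (proj₂ (proj₂ (H-edge (e₁ zero) (e₂ zero) (e₃ k) (e zero zero k))))
      x≡ : ∀ i → toℕ (x i) ≡ toℕ (e₁ i)
      x≡ i = let _ , _ , _ , eq , _ = H-edge (e₁ i) (e₂ zero) (e₃ zero) (e i zero zero) in eq
      y≡ : ∀ j → toℕ (y j) ≡ toℕ (e₂ j)
      y≡ j = let _ , _ , _ , _ , eq , _ = H-edge (e₁ zero) (e₂ j) (e₃ zero) (e zero j zero) in eq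
      z≡ : ∀ k → toℕ (z k) ≡ toℕ (e₃ k)
      z≡ k = let _ , _ , _ , _ , _ , eq , _ = H-edge (e₁ zero) (e₂ zero) (e₃ k) (e zero zero k) in eq
      x-injective : ∀ i j → x i ≡ x j → i ≡ j
      x-injective i j eq = e₁-injective (toℕ-injective (trans (sym (x≡ i)) (trans (cong toℕ eq) (x≡ j))))
      y-injective : ∀ i j → y i ≡ y j → i ≡ j
      y-injective i j eq = e₂-injective (toℕ-injective (trans (sym (y≡ i)) (trans (cong toℕ eq) (y≡ j))))
      z-injective : ∀ i j → z i ≡ z j → i ≡ j
      z-injective i j eq = e₃-injective (toℕ-injective (trans (sym (z≡ i)) (trans (cong toℕ eq) (z≡ j))))
      all-edges : ∀ i j k → R (x i) (y j) (z k) ≡ true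
      all-edges i j k =
        let i′ , j′ , k′ , i≡ , j≡ , k≡ , eq = H-edge (e₁ i) (e₂ j) (e₃ k) (e i j k)
        in subst (_≡ true) (trans (cong (λ u → R u j′ k′) (toℕ-injective (trans i≡ (sym (x≡ i)))))
             (trans (cong (λ v → R (x i) v k′) (toℕ-injective (trans j≡ (sym (y≡ j)))))
                    (cong (R (x i) (y j)) (toℕ-injective (trans k≡ (sym (z≡ k))))))) eq

    enumerate-exactly : ∀ {s} (S : Subset n) → ∣ S ∣ ≡ s → Σ (Fin s → Fin n) λ e → ((∀ {i j} → e i ≡ e j → i ≡ j) × (∀ i → e i ∈ S))
    enumerate-exactly S refl = enumerate S

    H-free : ¬ Grid R → KFree 2 2 7 H
    H-free no-grid (S₁ , S₂ , S₃ , ∣S₁∣ , ∣S₂∣ , ∣S₃∣ , K) =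
      let e₁ , e₁-injective , e₁∈ = enumerate-exactly S₁ ∣S₁∣
          e₂ , e₂-injective , e₂∈ = enumerate-exactly S₂ ∣S₂∣
          e₃ , e₃-injective , e₃∈ = enumerate-exactly S₃ ∣S₃∣
      in no-grid (grid e₁ e₂ e₃ e₁-injective e₂-injective e₃-injective λ i j k → K _ _ _ (e₁∈ i) (e₂∈ j) (e₃∈ k))

  grid-free⇒≤z₃ : ¬ Grid R → ∑[ i < a ] ∑[ j < b ] ∑[ k < c ] indicator (R i j k) ≤ z₃ n 2 2 7
  grid-free⇒≤z₃ no-grid = ≤-trans edges-H (z₃-upper H (H-free no-grid))

-- The construction

∃-max : ∀ {n} (f : Fin (suc n) → ℕ) → ∃[ r ] (∀ i → f i ≤ f r)
∃-max {zero}  f = zero , λ { zero → ≤-refl }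
∃-max {suc n} f with ∃-max (f ∘ suc)
... | r , f≤ with ≤-total (f zero) (f (suc r))
...   | inj₁ f₀≤ = suc r , λ { zero → f₀≤ ; (suc i) → f≤ i }
...   | inj₂ f₀≥ = zero , λ { zero → ≤-refl ; (suc i) → ≤-trans (f≤ i) f₀≥ }

∃-≥-average : ∀ {n} (f : Fin (suc n) → ℕ) → ∃[ r ] sum f ≤ suc n * f r
∃-≥-average f = let r , f≤ = ∃-max f in r , ∑-≤ (f r) f≤

term≤∑ : ∀ {n} (f : Fin n → ℕ) i → f i ≤ sum f
term≤∑ f zero    = m≤m+n (f zero) _
term≤∑ f (suc i) = ≤-trans (term≤∑ (f ∘ suc) i) (m≤n+m _ (f zero))

∑-mono-≡ : ∀ {n} {f g : Fin n → ℕ} → (∀ i → f i ≤ g i) → sum f ≡ sum g → ∀ i → f i ≡ g i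
∑-mono-≡ {suc n} {f} {g} f≤g eq = λ { zero → head ; (suc i) → ∑-mono-≡ (f≤g ∘ suc) tail i }
  where
  head : f zero ≡ g zero
  head = ≤-antisym (f≤g zero) (≮⇒≥ λ f₀<g₀ → <⇒≢ (+-mono-<-≤ f₀<g₀ (∑-mono (f≤g ∘ suc))) eq)
  tail : sum (f ∘ suc) ≡ sum (g ∘ suc)
  tail = +-cancelˡ-≡ (f zero) _ _ (trans eq (cong (_+ sum (g ∘ suc)) (sym head)))

-- With d = x′ - x = y - y′, the two sides differ by d².
square-gap : ∀ x y d → x * (d + y) + (x + d) * y + d * d ≡ x * y + (x + d) * (d + y)
square-gap = solve 3 (λ x y d → x :* (d :+ y) :+ (x :+ d) :* y :+ d :* d := x :* y :+ (x :+ d) :* (d :+ y)) refl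
  where open ℕ-Solver

rearrangement-≤ : ∀ x y x′ y′ → x + y ≡ x′ + y′ → x ≤ x′ →
  (x * y + x′ * y′ ≤ x * y′ + x′ * y) × (x * y + x′ * y′ ≡ x * y′ + x′ * y → x ≡ x′)
rearrangement-≤ x y x′ y′ eq x≤x′ = subst₂
  (λ x′ y → (x * y + x′ * y′ ≤ x * y′ + x′ * y) × (x * y + x′ * y′ ≡ x * y′ + x′ * y → x ≡ x′)) x+d≡x′ d+y′≡y
  ( subst (x * (d + y′) + (x + d) * y′ ≤_) (square-gap x y′ d) (m≤m+n _ (d * d))
  , λ e → trans (sym (+-identityʳ x)) (cong (_+_ x) (sym (d*d≡0⇒d≡0 d (m+n≡m⇒n≡0 _ (d * d) (trans (square-gap x y′ d) (sym e)))))))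
  where
  d = x′ ∸ x
  x+d≡x′ : x + d ≡ x′
  x+d≡x′ = m+[n∸m]≡n x≤x′
  d+y′≡y : d + y′ ≡ y
  d+y′≡y = sym (+-cancelˡ-≡ x y (d + y′) (trans eq (trans (cong (_+ y′) (sym x+d≡x′)) (+-assoc x d y′))))
  d*d≡0⇒d≡0 : ∀ d → d * d ≡ 0 → d ≡ 0
  d*d≡0⇒d≡0 zero _ = refl
  m+n≡m⇒n≡0 : ∀ m n → m + n ≡ m → n ≡ 0
  m+n≡m⇒n≡0 m n e = +-cancelˡ-≡ m n 0 (trans e (sym (+-identityʳ m)))

-- One coordinate of the identity for |u - u′|², without subtraction: an inequality together with
-- its equality case. `∑-mono-≡` then passes from equal inner products to equality in every
-- coordinate.
rearrangement : ∀ x y x′ y′ → x + y ≡ x′ + y′ →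
  (x * y + x′ * y′ ≤ x * y′ + x′ * y) × (x * y + x′ * y′ ≡ x * y′ + x′ * y → x ≡ x′)
rearrangement x y x′ y′ eq with ≤-total x x′
... | inj₁ x≤x′ = rearrangement-≤ x y x′ y′ eq x≤x′
... | inj₂ x′≤x =
  let lhs = +-comm (x′ * y′) (x * y)
      rhs = +-comm (x′ * y) (x * y′)
      le , strict = rearrangement-≤ x′ y′ x y (sym eq) x′≤x
  in subst₂ _≤_ lhs rhs le , λ e → sym (strict (trans lhs (trans e (sym rhs))))

funToFin-cong : ∀ {m n} {f g : Fin m → Fin n} → (∀ i → f i ≡ g i) → funToFin f ≡ funToFin g
funToFin-cong {zero}  f≗g = refl
funToFin-cong {suc m} f≗g = cong₂ combine (f≗g zero) (funToFin-cong (f≗g ∘ suc))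

module Coordinates (D m : ℕ) where
  private
    digits : Fin (D ^ m) → Fin m → Fin D
    digits = finToFun

  coordinate : Fin (D ^ m) → Fin m → ℕ
  coordinate u i = toℕ (digits u i)

  coordinate-injective : ∀ u v → (∀ i → coordinate u i ≡ coordinate v i) → u ≡ v
  coordinate-injective u v eq = trans (sym (funToFin-finToFin {m} {D} u))
    (trans (funToFin-cong (λ i → toℕ-injective (eq i))) (funToFin-finToFin {m} {D} v))

  ⟪_,_⟫ : Fin (D ^ m) → Fin (D ^ m) → ℕ
  ⟪ u , v ⟫ = ∑[ i < m ] (coordinate u i * coordinate v i)

  ⟪,⟫≤ : ∀ u v → ⟪ u , v ⟫ ≤ m * (D * D)
  ⟪,⟫≤ u v = ∑-≤ (D * D) λ i → *-mono-≤ (<⇒≤ (toℕ<n (digits u i))) (<⇒≤ (toℕ<n (digits v i)))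

  -- The sum u + v, that is, twice the midpoint. Its coordinates are below 2D and are stored as
  -- digits without carries.
  midpoint : Fin (D ^ m) → Fin (D ^ m) → Fin ((D + D) ^ m)
  midpoint u v = funToFin λ i → fromℕ< (+-mono-< (toℕ<n (digits u i)) (toℕ<n (digits v i)))

  midpoint-≡ : ∀ u v u′ v′ → midpoint u v ≡ midpoint u′ v′ →
    ∀ i → coordinate u i + coordinate v i ≡ coordinate u′ i + coordinate v′ i
  midpoint-≡ u v u′ v′ eq i = trans (sym (digit u v)) (trans (cong (λ w → toℕ (finToFun w i)) eq) (digit u′ v′))
    where
    digit : ∀ u v → toℕ (finToFun (midpoint u v) i) ≡ coordinate u i + coordinate v i
    digit u v = trans (cong toℕ (finToFun-funToFin _ i)) (toℕ-fromℕ< _)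

  midpoint-injective-on-grids : ∀ u v u′ v′ → midpoint u v ≡ midpoint u′ v′ →
    ⟪ u , v ⟫ + ⟪ u′ , v′ ⟫ ≡ ⟪ u , v′ ⟫ + ⟪ u′ , v ⟫ → u ≡ u′ × v ≡ v′
  midpoint-injective-on-grids u v u′ v′ mid eq =
    coordinate-injective u u′ u≡ , coordinate-injective v v′ λ i →
      +-cancelˡ-≡ (coordinate u i) _ _ (trans (midpoint-≡ u v u′ v′ mid i) (cong (_+ coordinate v′ i) (sym (u≡ i))))
    where
    rearranged = λ i → rearrangement (coordinate u i) (coordinate v i) (coordinate u′ i) (coordinate v′ i) (midpoint-≡ u v u′ v′ mid i)
    u≡ : ∀ i → coordinate u i ≡ coordinate u′ i
    u≡ i = proj₂ (rearranged i) (∑-mono-≡ (λ i → proj₁ (rearranged i))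
      (trans (∑-distrib-+ (λ i → coordinate u i * coordinate v i) (λ i → coordinate u′ i * coordinate v′ i))
        (trans eq (sym (∑-distrib-+ (λ i → coordinate u i * coordinate v′ i) (λ i → coordinate u′ i * coordinate v i))))) i)

⌊⌋≡true⇒ : ∀ {P : Set} (P? : Dec P) → ⌊ P? ⌋ ≡ true → P
⌊⌋≡true⇒ (yes p) _ = p

⇒⌊⌋≡true : ∀ {P : Set} (P? : Dec P) → P → ⌊ P? ⌋ ≡ true
⇒⌊⌋≡true (yes _) _ = refl
⇒⌊⌋≡true (no ¬p) p = contradiction p ¬p

module Construction (p : ℕ) (p-prime : Prime p) (D m : ℕ) (room : (D + D) ^ m ≤ (p * (p * p)) * pred p) where
  open ModPrime p p-prime
  open Coordinates D m
  private
    a : ℤ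
    a = proj₁ ∃-rootless
  open CubicOrder a using (Order; norm; _⊞_)
  open CubicResidueField p p-prime a (proj₂ ∃-rootless)

  element : Fin (p * (p * p)) → Order
  element i = let i₀ , jk = remQuot {p} (p * p) i ; i₁ , i₂ = remQuot {p} p jk in ⟨ + toℕ i₀ , + toℕ i₁ , + toℕ i₂ ⟩

  remQuot-injective : ∀ {k} n (i j : Fin (k * n)) →
    proj₁ (remQuot {k} n i) ≡ proj₁ (remQuot {k} n j) → proj₂ (remQuot {k} n i) ≡ proj₂ (remQuot {k} n j) → i ≡ j
  remQuot-injective {k} n i j eq₁ eq₂ = trans (sym (combine-remQuot {k} n i)) (trans (cong₂ combine eq₁ eq₂) (combine-remQuot {k} n j))

  element-injective : ∀ i j → I (element i ⊖ element j) → i ≡ j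
  element-injective i j d = remQuot-injective {p} (p * p) i j (toℕ-injective-mod _ _ (I⇒∣₀ d))
    (remQuot-injective {p} p _ _ (toℕ-injective-mod _ _ (I⇒∣₁ d)) (toℕ-injective-mod _ _ (I⇒∣₂ d)))

  scalar : Fin (pred p) → ℤ
  scalar i = + suc (toℕ i)

  scalar<p : ∀ i → suc (toℕ i) < p
  scalar<p i = subst (suc (suc (toℕ i)) ≤_) (suc-pred p) (s≤s (toℕ<n i))

  label : Fin ((p * (p * p)) * pred p) → Fin (p * (p * p)) → Fin p
  label v B = let A , c = remQuot {p * (p * p)} (pred p) v in fromℕ< (n%ℕd<d (scalar c ℤ.* norm (element A ⊞ element B)) p)

  label-≡ : ∀ v B → let A , c = remQuot {p * (p * p)} (pred p) v in p∣ scalar c ℤ.* norm (element A ⊞ element B) ℤ.- + toℕ (label v B)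
  label-≡ v B = let A , c = remQuot {p * (p * p)} (pred p) v ; x = scalar c ℤ.* norm (element A ⊞ element B) in
    subst (λ r → p∣ x ℤ.- + r) (sym (toℕ-fromℕ< (n%ℕd<d x p))) (p∣-% x)

  vertex : Fin (D ^ m) → Fin (D ^ m) → Fin ((p * (p * p)) * pred p)
  vertex u v = inject≤ (midpoint u v) room

  module _ (r : ℕ) where
    R : Fin (D ^ m) → Fin (D ^ m) → Fin ((p * (p * p)) * p) → Bool
    R u v z = ⌊ ⟪ u , v ⟫ ℕₚ.≟ r ⌋ ∧ ⌊ label (vertex u v) (proj₁ (remQuot {p * (p * p)} p z)) ≟ proj₂ (remQuot {p * (p * p)} p z) ⌋

    no-grid : ¬ Grid R
    no-grid g = norm-graph-K₄₇-free (element ∘ A) (scalar ∘ c) (element ∘ B) (λ k → + toℕ (b k))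
      (λ t d → contradiction
        (p∣m-n⇒m≡n (scalar<p (c t)) (<-trans z<s (scalar<p (c t))) (subst p∣_ (sym (ℤₚ.+-identityʳ (scalar (c t)))) d))
        λ ())
      (λ {t} {t′} t≢t′ d e → t≢t′ (w-injective t t′ (remQuot-injective {p * (p * p)} (pred p) (w t) (w t′)
        (element-injective _ _ d) (scalar-injective (c t) (c t′) e))))
      (λ {k} {l} k≢l d e → k≢l (z-injective k l (remQuot-injective {p * (p * p)} p (z k) (z l)
        (element-injective _ _ d) (toℕ-injective-mod (b k) (b l) e))))
      (λ t k → subst (λ y → p∣ scalar (c t) ℤ.* norm (element (A t) ⊞ element (B k)) ℤ.- + toℕ y)
        (label≡b t k) (label-≡ (w t) (B k)))
      where
      open Grid g
      ij : Fin 4 → Fin 2 × Fin 2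
      ij = remQuot 2
      w : Fin 4 → Fin ((p * (p * p)) * pred p)
      w t = vertex (x (proj₁ (ij t))) (y (proj₂ (ij t)))
      A : Fin 4 → Fin (p * (p * p))
      A t = proj₁ (remQuot {p * (p * p)} (pred p) (w t))
      c : Fin 4 → Fin (pred p)
      c t = proj₂ (remQuot {p * (p * p)} (pred p) (w t))
      B : Fin 7 → Fin (p * (p * p))
      B k = proj₁ (remQuot {p * (p * p)} p (z k))
      b : Fin 7 → Fin p
      b k = proj₂ (remQuot {p * (p * p)} p (z k))
      dot≡r : ∀ i j → ⟪ x i , y j ⟫ ≡ r
      dot≡r i j = ⌊⌋≡true⇒ (⟪ x i , y j ⟫ ℕₚ.≟ r) (∧-conicalˡ _ _ (edge i j zero))
      label≡b : ∀ t k → label (w t) (B k) ≡ b k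
      label≡b t k = ⌊⌋≡true⇒ (label (w t) (B k) ≟ b k)
        (∧-conicalʳ ⌊ ⟪ x (proj₁ (ij t)) , y (proj₂ (ij t)) ⟫ ℕₚ.≟ r ⌋ _ (edge (proj₁ (ij t)) (proj₂ (ij t)) k))
      scalar-injective : ∀ i j → p∣ scalar i ℤ.- scalar j → i ≡ j
      scalar-injective i j d = toℕ-injective (ℕₚ.suc-injective (p∣m-n⇒m≡n (scalar<p i) (scalar<p j) d))
      w-injective : ∀ t t′ → w t ≡ w t′ → t ≡ t′
      w-injective t t′ eq =
        let i , j = ij t ; i′ , j′ = ij t′
            x≡ , y≡ = midpoint-injective-on-grids (x i) (y j) (x i′) (y j′) (inject≤-injective room room _ _ eq)
              (trans (cong₂ _+_ (dot≡r i j) (dot≡r i′ j′)) (sym (cong₂ _+_ (dot≡r i j′) (dot≡r i′ j))))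
        in remQuot-injective {2} 2 t t′ (x-injective i i′ x≡) (y-injective j j′ y≡)

    count : ℕ
    count = ∑[ u < D ^ m ] ∑[ v < D ^ m ] indicator ⌊ ⟪ u , v ⟫ ℕₚ.≟ r ⌋

    count-edges : (p * (p * p)) * count ≤ ∑[ u < D ^ m ] ∑[ v < D ^ m ] ∑[ z < (p * (p * p)) * p ] indicator (R u v z)
    count-edges = begin
      q * count
        ≡⟨ *-distribˡ-sum q (λ u → ∑[ v < D ^ m ] e u v) ⟩
      ∑[ u < D ^ m ] (q * ∑[ v < D ^ m ] e u v)
        ≡⟨ sum-cong-≗ (λ u → *-distribˡ-sum q (e u)) ⟩
      ∑[ u < D ^ m ] ∑[ v < D ^ m ] (q * e u v)
        ≡⟨ sum-cong-≗ (λ u → sum-cong-≗ λ v → ∑-const q (e u v)) ⟨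
      ∑[ u < D ^ m ] ∑[ v < D ^ m ] ∑[ B < q ] e u v
        ≤⟨ ∑-mono (λ u → ∑-mono λ v → ∑-mono λ B → ≤-trans (≤-reflexive (sym (edge-at-label u v B)))
            (term≤∑ (λ b → indicator (R u v (combine B b))) (label (vertex u v) B))) ⟩
      ∑[ u < D ^ m ] ∑[ v < D ^ m ] ∑[ B < q ] ∑[ b < p ] indicator (R u v (combine B b))
        ≡⟨ sum-cong-≗ (λ u → sum-cong-≗ λ v → ∑-combine q (λ z → indicator (R u v z))) ⟨
      ∑[ u < D ^ m ] ∑[ v < D ^ m ] ∑[ z < q * p ] indicator (R u v z) ∎
      where
      open ≤-Reasoning
      q = p * (p * p)
      e : Fin (D ^ m) → Fin (D ^ m) → ℕ
      e u v = indicator ⌊ ⟪ u , v ⟫ ℕₚ.≟ r ⌋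
      edge-at-label : ∀ u v B → indicator (R u v (combine B (label (vertex u v) B))) ≡ e u v
      edge-at-label u v B = trans
        (cong (λ (B′ , b) → indicator (⌊ ⟪ u , v ⟫ ℕₚ.≟ r ⌋ ∧ ⌊ label (vertex u v) B′ ≟ b ⌋)) (remQuot-combine B (label (vertex u v) B)))
        (trans (cong (λ t → indicator (⌊ ⟪ u , v ⟫ ℕₚ.≟ r ⌋ ∧ t)) (⇒⌊⌋≡true (label (vertex u v) B ≟ label (vertex u v) B) refl))
          (trans (indicator-∧ ⌊ ⟪ u , v ⟫ ℕₚ.≟ r ⌋ true) (*-identityʳ _)))

  popular-inner-product : ∃[ r ] (D ^ m) * (D ^ m) ≤ suc (m * (D * D)) * count r
  popular-inner-product =
    let r , large = ∃-≥-average {m * (D * D)} (count ∘ toℕ)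
    in toℕ r , ≤-trans (begin
      (D ^ m) * (D ^ m)                                                       ≡⟨ ∑-const (D ^ m) (D ^ m) ⟨
      ∑[ u < D ^ m ] (D ^ m)                                                  ≡⟨ sum-cong-≗ {D ^ m} (λ u → trans (sym (*-identityʳ (D ^ m))) (sym (∑-const (D ^ m) 1))) ⟩
      ∑[ u < D ^ m ] ∑[ v < D ^ m ] 1                                         ≤⟨ ∑-mono (λ u → ∑-mono λ v → one≤ u v) ⟩
      ∑[ u < D ^ m ] ∑[ v < D ^ m ] ∑[ r < suc (m * (D * D)) ] e u v r        ≡⟨ sum-cong-≗ (λ u → ∑-comm (e u)) ⟩
      ∑[ u < D ^ m ] ∑[ r < suc (m * (D * D)) ] ∑[ v < D ^ m ] e u v r        ≡⟨ ∑-comm (λ u r → ∑[ v < D ^ m ] e u v r) ⟩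
      ∑[ r < suc (m * (D * D)) ] count (toℕ r)                                ∎) large
    where
    open ≤-Reasoning
    e : Fin (D ^ m) → Fin (D ^ m) → Fin (suc (m * (D * D))) → ℕ
    e u v r = indicator ⌊ ⟪ u , v ⟫ ℕₚ.≟ toℕ r ⌋
    one≤ : ∀ u v → 1 ≤ ∑[ r < suc (m * (D * D)) ] e u v r
    one≤ u v = ≤-trans (≤-reflexive (sym (cong indicator (⇒⌊⌋≡true (⟪ u , v ⟫ ℕₚ.≟ toℕ r) (sym (toℕ-fromℕ< bound)))))) (term≤∑ (e u v) r)
      where
      bound = s≤s (⟪,⟫≤ u v)
      r = fromℕ< bound

  z₃-lower : ∀ n → D ^ m ≤ n → (p * (p * p)) * p ≤ n →
    (p * (p * p)) * ((D ^ m) * (D ^ m)) ≤ suc (m * (D * D)) * z₃ n 2 2 7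
  z₃-lower n D^m≤n p⁴≤n =
    let r , large = popular-inner-product
        q = p * (p * p)
        s = suc (m * (D * D))
    in begin
    q * ((D ^ m) * (D ^ m))      ≤⟨ *-monoʳ-≤ q large ⟩
    q * (s * count r)            ≡⟨ solve 3 (λ q s c → q :* (s :* c) := s :* (q :* c)) refl q s (count r) ⟩
    s * (q * count r)            ≤⟨ *-monoʳ-≤ s (≤-trans (count-edges r) (grid-free⇒≤z₃ D^m≤n D^m≤n p⁴≤n (R r) (no-grid r))) ⟩
    s * z₃ n 2 2 7               ∎
    where open ≤-Reasoning
          open ℕ-Solver

-- Asymptotics

z₃⁴≤8n¹¹ : ∀ n → z₃ n 2 2 7 ^ 4 ≤ 8 * n ^ 11
z₃⁴≤8n¹¹ n = let H , free , eq = z₃-attained n 2 2 7 in subst (λ z → z ^ 4 ≤ 8 * n ^ 11) eq (KFree⇒#edges⁴≤8n¹¹ H free)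

-- D is the largest base for which all midpoints fit into the norm graph of 𝔽ₚ.
module LowerBound (p : ℕ) (p-prime : Prime p) (m n : ℕ) (0<m : 0 < m) (p⁴≤n : p ^ 4 ≤ n) (2^m<p : 2 ^ m < p) where
  open ≤-Reasoning
  open ℕ-Solver
  private
    z = z₃ n 2 2 7
    q = (p * (p * p)) * pred p

    p>0 : 0 < p
    p>0 = ≤-trans (s≤s z≤n) 2^m<p

    instance
      p≢0 : NonZero p
      p≢0 = >-nonZero p>0
      m≢0 : NonZero m
      m≢0 = >-nonZero 0<m

    p⁴≡ : (p * (p * p)) * p ≡ p ^ 4
    p⁴≡ = solve 1 (λ p → (p :* (p :* p)) :* p := p :^ 4) refl p

    q≤p⁴ : q ≤ p ^ 4
    q≤p⁴ = ≤-trans (*-monoʳ-≤ (p * (p * p)) (pred[n]≤n {p})) (≤-reflexive p⁴≡)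

    2^m≤q : 2 ^ m ≤ q
    2^m≤q = ≤-trans (<⇒≤pred 2^m<p) (m≤n*m (pred p) (p * (p * p)) {{m*n≢0 p (p * p) {{p≢0}} {{m*n≢0 p p}}}})

    fits = threshold (λ D → (D + D) ^ m ≤? q) (≤-trans (≤-reflexive (0^m≡0 m)) z≤n) (suc n) λ fit → <⇒≱ (≤-<-trans q≤p⁴ (≤-<-trans p⁴≤n (begin-strict
        n                          <⟨ n<1+n n ⟩
        suc n                      ≤⟨ m≤m+n (suc n) (suc n) ⟩
        suc n + suc n              ≡⟨ ^-identityʳ (suc n + suc n) ⟨
        (suc n + suc n) ^ 1        ≤⟨ ^-monoʳ-≤ (suc n + suc n) 0<m ⟩
        (suc n + suc n) ^ m        ∎))) fit
      where
      0^m≡0 : ∀ m .{{_ : NonZero m}} → 0 ^ m ≡ 0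
      0^m≡0 (suc m) = refl
    D = proj₁ fits

    D≢0 : D ≢ 0
    D≢0 D≡0 = proj₂ (proj₂ fits) (subst (λ D → (suc D + suc D) ^ m ≤ q) (sym D≡0) 2^m≤q)

    -- 2 from p ≤ 2(p-1), and 4^m from 2(D+1) ≤ 4D, where D + 1 is the first base that no longer
    -- fits.
    C₁ = 2 * 4 ^ m

    p⁴≤C₁D^m : p ^ 4 ≤ C₁ * D ^ m
    p⁴≤C₁D^m = begin
      p ^ 4                              ≡⟨ p⁴≡ ⟨
      (p * (p * p)) * p                  ≤⟨ *-monoʳ-≤ (p * (p * p)) (begin
        p                                  ≡⟨ suc-pred p ⟨
        1 + pred p                         ≤⟨ +-monoˡ-≤ (pred p) (≤-trans (m^n>0 2 m) (<⇒≤pred 2^m<p)) ⟩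
        pred p + pred p                    ∎) ⟩
      (p * (p * p)) * (pred p + pred p)  ≡⟨ solve 2 (λ a b → a :* (b :+ b) := con 2 :* (a :* b)) refl (p * (p * p)) (pred p) ⟩
      2 * q                              ≤⟨ *-monoʳ-≤ 2 (begin
        q                                  ≤⟨ <⇒≤ (≰⇒> (proj₂ (proj₂ fits))) ⟩
        (suc D + suc D) ^ m                ≤⟨ ^-monoˡ-≤ m (begin
          (1 + D) + (1 + D)                  ≤⟨ +-mono-≤ 1+D≤2D 1+D≤2D ⟩
          (D + D) + (D + D)                  ≡⟨ solve 1 (λ d → (d :+ d) :+ (d :+ d) := con 4 :* d) refl D ⟩
          4 * D                              ∎) ⟩
        (4 * D) ^ m                        ≡⟨ ^-distribʳ-* m 4 D ⟩
        4 ^ m * D ^ m                      ∎) ⟩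
      2 * (4 ^ m * D ^ m)                ≡⟨ *-assoc 2 (4 ^ m) (D ^ m) ⟨
      C₁ * D ^ m                         ∎
      where
      1+D≤2D : 1 + D ≤ D + D
      1+D≤2D = +-monoˡ-≤ D (n≢0⇒n>0 D≢0)

  D^m≤n : D ^ m ≤ n
  D^m≤n = ≤-trans (^-monoˡ-≤ m (m≤m+n D D)) (≤-trans (proj₁ (proj₂ fits)) (≤-trans q≤p⁴ p⁴≤n))

  base : ℕ
  base = D

  -- `C₁` enters once for u and once for v; 2m comes from the mD² + 1 ≤ 2mD² possible inner
  -- products.
  C : ℕ
  C = C₁ * C₁ * (2 * m)

  p¹¹≤CD²z : p ^ 11 ≤ C * (D * D) * z
  p¹¹≤CD²z = begin
    p ^ 11                                              ≡⟨ solve 1 (λ p → p :^ 11 := (p :* (p :* p)) :* (p :^ 4 :* p :^ 4)) refl p ⟩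
    (p * (p * p)) * (p ^ 4 * p ^ 4)                     ≤⟨ *-monoʳ-≤ (p * (p * p)) (*-mono-≤ p⁴≤C₁D^m p⁴≤C₁D^m) ⟩
    (p * (p * p)) * ((C₁ * D ^ m) * (C₁ * D ^ m))       ≡⟨ solve 3 (λ a c d → a :* ((c :* d) :* (c :* d)) := c :* c :* (a :* (d :* d))) refl (p * (p * p)) C₁ (D ^ m) ⟩
    C₁ * C₁ * ((p * (p * p)) * (D ^ m * D ^ m))         ≤⟨ *-monoʳ-≤ (C₁ * C₁) (Construction.z₃-lower p p-prime D m (proj₁ (proj₂ fits)) n D^m≤n (≤-trans (≤-reflexive p⁴≡) p⁴≤n)) ⟩
    C₁ * C₁ * (suc (m * (D * D)) * z)                   ≤⟨ *-monoʳ-≤ (C₁ * C₁) (*-monoˡ-≤ z (+-monoˡ-≤ (m * (D * D)) (*-mono-≤ 0<m (*-mono-≤ (n≢0⇒n>0 D≢0) (n≢0⇒n>0 D≢0))))) ⟩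
    C₁ * C₁ * ((m * (D * D) + m * (D * D)) * z)         ≡⟨ solve 4 (λ c m d z → c :* ((m :* d :+ m :* d) :* z) := c :* (con 2 :* m) :* d :* z) refl (C₁ * C₁) m (D * D) z ⟩
    C * (D * D) * z                                     ∎

-- That is, z₃ ≥ n^(11/4 - 3/(4k)). The loss n³ has one factor n for the gap between p⁴ and n, with
-- J = 11k since p¹¹ is raised to the power 4k; one for C^(4k); and one for (D²)^(4k) = D^m ≤ n,
-- which is why m = 8k.
z₃-near-optimal : ∀ k → 0 < k → ∃[ N ] ∀ n → N ≤ n → n ^ (11 * k) ≤ z₃ n 2 2 7 ^ (4 * k) * n ^ 3
z₃-near-optimal k 0<k = N , bound
  where
  open ≤-Reasoning
  open ℕ-Solver
  m = 8 * k
  J = 11 * k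
  C = 2 * 4 ^ m * (2 * 4 ^ m) * (2 * m)
  N₀ = proj₁ (dense-primes J)
  N = N₀ + ((2 ^ m) ^ (4 * J) + C ^ (4 * k)) + 1

  0<m : 0 < m
  0<m = *-mono-≤ {1} {8} (s≤s z≤n) 0<k

  bound : ∀ n → N ≤ n → n ^ (11 * k) ≤ z₃ n 2 2 7 ^ (4 * k) * n ^ 3
  bound n N≤n =
    let p , p-prime , p⁴≤n , n^J≤ = proj₂ (dense-primes J) n (≤-trans (≤-trans (m≤m+n N₀ _) (m≤m+n _ 1)) N≤n)
    in near-optimal p p-prime p⁴≤n n^J≤
    where
    z = z₃ n 2 2 7
    n>0 : 0 < n
    n>0 = ≤-trans (m≤n+m 1 _) N≤n
    instance
      n≢0 : NonZero n
      n≢0 = >-nonZero n>0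

    tail≤n : (2 ^ m) ^ (4 * J) + C ^ (4 * k) < n
    tail≤n = ≤-trans (≤-trans (≤-reflexive (+-comm 1 _)) (+-monoˡ-≤ 1 (m≤n+m _ N₀))) N≤n

    module _ (p : ℕ) (p-prime : Prime p) (p⁴≤n : p ^ 4 ≤ n) (n^J≤ : n ^ J ≤ p ^ (4 * J) * n) where
      -- Makes p grow with n, so that p exceeds 2^m; since J ≥ 2, one factor n of n^J can be given
      -- away.
      n≤p^4J : n ≤ p ^ (4 * J)
      n≤p^4J = *-cancelʳ-≤ n (p ^ (4 * J)) n (begin
        n * n              ≡⟨ cong (n *_) (*-identityʳ n) ⟨
        n ^ 2              ≤⟨ ^-monoʳ-≤ n (≤-trans (m≤m+n 2 9) (*-monoʳ-≤ 11 0<k)) ⟩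
        n ^ J              ≤⟨ n^J≤ ⟩
        p ^ (4 * J) * n    ∎)

      2^m<p : 2 ^ m < p
      2^m<p = ≰⇒> λ p≤2^m → <⇒≱ tail≤n (≤-trans n≤p^4J (≤-trans (^-monoˡ-≤ (4 * J) p≤2^m) (m≤m+n _ _)))

      open LowerBound p p-prime m n 0<m p⁴≤n 2^m<p using (base; D^m≤n; p¹¹≤CD²z)

      near-optimal : n ^ (11 * k) ≤ z ^ (4 * k) * n ^ 3
      near-optimal = begin
        n ^ (11 * k)                                       ≤⟨ n^J≤ ⟩
        p ^ (4 * (11 * k)) * n                             ≡⟨ cong (λ e → p ^ e * n) (solve 1 (λ k → con 4 :* (con 11 :* k) := con 11 :* (con 4 :* k)) refl k) ⟩
        p ^ (11 * (4 * k)) * n                             ≡⟨ cong (_* n) (^-*-assoc p 11 (4 * k)) ⟨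
        (p ^ 11) ^ (4 * k) * n                             ≤⟨ *-monoˡ-≤ n (^-monoˡ-≤ (4 * k) p¹¹≤CD²z) ⟩
        (C * (base * base) * z) ^ (4 * k) * n              ≡⟨ cong (_* n) (trans (^-distribʳ-* (4 * k) (C * (base * base)) z) (cong (_* z ^ (4 * k)) (^-distribʳ-* (4 * k) C (base * base)))) ⟩
        C ^ (4 * k) * (base * base) ^ (4 * k) * z ^ (4 * k) * n
          ≤⟨ *-monoˡ-≤ n (*-monoˡ-≤ (z ^ (4 * k)) (*-mono-≤ (<⇒≤ (≤-<-trans (m≤n+m (C ^ (4 * k)) ((2 ^ m) ^ (4 * J))) tail≤n))
            (≤-trans (≤-reflexive base^) D^m≤n))) ⟩
        n * n * z ^ (4 * k) * n                            ≡⟨ solve 2 (λ n z → n :* n :* z :* n := z :* n :^ 3) refl n (z ^ (4 * k)) ⟩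
        z ^ (4 * k) * n ^ 3                                ∎
        where
        base^ : (base * base) ^ (4 * k) ≡ base ^ m
        base^ = trans (cong (_^ (4 * k)) (solve 1 (λ b → b :* b := b :^ 2) refl base))
          (trans (^-*-assoc base 2 (4 * k)) (cong (base ^_) (solve 1 (λ k → con 2 :* (con 4 :* k) := con 8 :* k) refl k)))

-- The numerator 11d - 4s of 11/4 - s/d can have either sign, so the comparison does not reduce
-- until its sign is known.
<log-cases : ∀ (x : ℤ) b {m n} →
  (∀ a → x ≡ + a → n ^ a < m ^ suc b) → (∀ a → x ≡ -[1+ a ] → 1 < m ^ suc b * n ^ suc a) → mkℚᵘ x b <log m /log n
<log-cases (+ a)    b pos neg = pos a refl
<log-cases -[1+ a ] b pos neg = neg a refl

module Bounds (n d s : ℕ) (0<s : 0 < s) (2≤n : 2 ≤ n) where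
  open ≤-Reasoning
  open ℕ-Solver
  private
    z = z₃ n 2 2 7
    instance
      n≢0 : NonZero n
      n≢0 = >-nonZero (<⇒≤ 2≤n)

    n≤n^4s : n ≤ n ^ (4 * s)
    n≤n^4s = ≤-trans (≤-reflexive (sym (^-identityʳ n))) (^-monoʳ-≤ n (≤-trans 0<s (m≤n*m s 4)))

  z₃^4d<n^[11d+4s] : 8 ^ d < n → z ^ (4 * d) < n ^ (11 * d + 4 * s)
  z₃^4d<n^[11d+4s] 8^d<n = begin-strict
    z ^ (4 * d)                      ≡⟨ ^-*-assoc z 4 d ⟨
    (z ^ 4) ^ d                      ≤⟨ ^-monoˡ-≤ d (z₃⁴≤8n¹¹ n) ⟩
    (8 * n ^ 11) ^ d                 ≡⟨ ^-distribʳ-* d 8 (n ^ 11) ⟩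
    8 ^ d * (n ^ 11) ^ d             <⟨ *-monoˡ-< ((n ^ 11) ^ d) {{m^n≢0 (n ^ 11) d {{m^n≢0 n 11}}}} (<-≤-trans 8^d<n n≤n^4s) ⟩
    n ^ (4 * s) * (n ^ 11) ^ d       ≡⟨ *-comm (n ^ (4 * s)) _ ⟩
    (n ^ 11) ^ d * n ^ (4 * s)       ≡⟨ cong (_* n ^ (4 * s)) (^-*-assoc n 11 d) ⟩
    n ^ (11 * d) * n ^ (4 * s)       ≡⟨ ^-distribˡ-+-* n (11 * d) (4 * s) ⟨
    n ^ (11 * d + 4 * s)             ∎

  module _ (near-optimal : n ^ (11 * d) ≤ z ^ (4 * d) * n ^ 3) where
    n^a<z₃^4d : ∀ a → a + 4 * s ≡ 11 * d → n ^ a < z ^ (4 * d)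
    n^a<z₃^4d a a+4s≡11d = begin-strict
      -- The margin n^(4s) is at least n⁴ and the loss is n³; the factor n left over makes the
      -- inequality strict.
      n ^ a                  <⟨ m<m*n (n ^ a) n {{m^n≢0 n a}} 2≤n ⟩
      n ^ a * n              ≤⟨ *-cancelʳ-≤ (n ^ a * n) (z ^ (4 * d)) (n ^ 3) {{m^n≢0 n 3}} (begin
        n ^ a * n * n ^ 3      ≡⟨ *-assoc (n ^ a) n (n ^ 3) ⟩
        n ^ a * n ^ 4          ≤⟨ *-monoʳ-≤ (n ^ a) (^-monoʳ-≤ n (*-monoʳ-≤ 4 0<s)) ⟩
        n ^ a * n ^ (4 * s)    ≡⟨ ^-distribˡ-+-* n a (4 * s) ⟨
        n ^ (a + 4 * s)        ≡⟨ cong (n ^_) a+4s≡11d ⟩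
        n ^ (11 * d)           ≤⟨ near-optimal ⟩
        z ^ (4 * d) * n ^ 3    ∎) ⟩
      z ^ (4 * d)            ∎

    1<z₃^4d*n^ : ∀ a → 1 < z ^ (4 * d) * n ^ suc a
    1<z₃^4d*n^ a = ≤-trans 2≤n (≤-trans (m≤m*n n (n ^ a) {{m^n≢0 n a}}) (m≤n*m (n ^ suc a) (z ^ (4 * d)) {{≢-nonZero z^≢0}}))
      where
      z^≢0 : z ^ (4 * d) ≢ 0
      z^≢0 eq = <⇒≱ (m^n>0 n (11 * d)) (subst (λ t → n ^ (11 * d) ≤ t * n ^ 3) eq near-optimal)

mainTheorem3 : LogRatioTendsTo (λ n → z₃ n 2 2 7) (+ 11 / 4)
mainTheorem3 (mkℚᵘ (+ zero)    d-1) (*<* (ℤ.+<+ ()))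
mainTheorem3 (mkℚᵘ (+ s@(suc _)) d-1) 0<ε = N , λ n N≤n →
  let 2≤n   = ≤-trans (m≤n+m 2 _) N≤n
      8^d<n = ≤-trans (≤-trans (≤-reflexive (+-comm 1 (8 ^ d))) (+-mono-≤ (m≤n+m (8 ^ d) N₀) (s≤s {0} z≤n))) N≤n
      near  = proj₂ (z₃-near-optimal d z<s) n (≤-trans (m≤m+n N₀ _) (≤-trans (m≤m+n _ 2) N≤n))
      open Bounds n d s z<s 2≤n
  in <log-cases _ _ (λ a eq → n^a<z₃^4d near a (exponent a eq)) (λ a _ → 1<z₃^4d*n^ near a)
   , subst (λ e → z₃ n 2 2 7 ^ (4 * d) < n ^ (11 * d + e)) (*-comm 4 s) (z₃^4d<n^[11d+4s] 8^d<n)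
  where
  d = suc d-1
  N₀ = proj₁ (z₃-near-optimal d z<s)
  N = N₀ + 8 ^ d + 2
  exponent : ∀ a → (+ 11) ℤ.* (+ d) ℤ.+ (ℤ.- (+ s)) ℤ.* (+ 4) ≡ + a → a + 4 * s ≡ 11 * d
  exponent a eq = ℤₚ.+-injective (begin
    + a ℤ.+ + (4 * s)                                                   ≡⟨ cong₂ ℤ._+_ (sym eq) (ℤₚ.pos-* 4 s) ⟩
    (+ 11) ℤ.* (+ d) ℤ.+ (ℤ.- (+ s)) ℤ.* (+ 4) ℤ.+ (+ 4) ℤ.* (+ s)    ≡⟨ ℤ-solve (+ d) (+ s) ⟩
    (+ 11) ℤ.* (+ d)                                                    ≡⟨ ℤₚ.pos-* 11 d ⟨
    + (11 * d)                                                          ∎)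
    where
    open ≡-Reasoning
    open ℤ-Solver
    ℤ-solve : ∀ d s → (+ 11) ℤ.* d ℤ.+ (ℤ.- s) ℤ.* (+ 4) ℤ.+ (+ 4) ℤ.* s ≡ (+ 11) ℤ.* d
    ℤ-solve = solve 2 (λ d s → con (+ 11) :* d :+ (:- s) :* con (+ 4) :+ con (+ 4) :* s := con (+ 11) :* d) refl
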